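{- Let $\Gamma$ be a finite undirected regular graph of valency at least $4$, and suppose there is a finite solvable group $G$ acting on $V(\Gamma)$ by automorphisms of $\Gamma$ such that $\Gamma$ is $G$-arc-transitive. Then $\Gamma$ admits a nowhere-zero $3$-flow.
   Context: All graphs and groups are finite. A group $G$ acts on a graph $\Gamma$ by automorphisms (not necessarily faithfully) if $G$ acts on $V(\Gamma)$ so that for all $\alpha,\beta\in V(\Gamma)$ and $g\in G$, $\alpha,\beta$ are adjacent iff $\alpha^g,\beta^g$ are adjacent. $\Gamma$ is $G$-arc-transitive if $G$ is transitive on $V(\Gamma)$ and transitive on the set of arcs of $\Gamma$, an arc being an ordered pair of adjacent vertices. For an integer $k\ge 2$ and a graph $\Gamma$ endowed with an orientation, a $k$-flow is a function $f:E(\Gamma)\to\{0,\pm1,\dots,\pm(k-1)\}$ such that for every vertex $v$, $\sum_{e\in E^+(v)}f(e)=\sum_{e\in E^-(v)}f(e)$, where $E^+(v)$ (resp. $E^-(v)$) is the set of edges with tail (resp. head) $v$. It is nowhere-zero if $f(e)\neq 0$ for all $e$. Whether a graph admits a nowhere-zero $k$-flow is independent of the orientation chosen. -}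

module Defs where

open import Level using (0ℓ)
open import Data.Bool using (Bool; true; false; if_then_else_; _∧_; T)
open import Data.Nat using (ℕ; _≤_; _<_)
open import Data.Fin using (Fin)
open import Data.List using (List; length; filterᵇ; allFin; map; foldr)
open import Data.Integer as ℤ using (ℤ; 0ℤ; +_; -_)
open import Data.Product using (Σ; ∃; _×_; _,_)
open import Data.Sum using (_⊎_)
open import Relation.Nullary using (¬_)
open import Relation.Binary.PropositionalEquality using (_≡_)
open import Algebra.Structures using (IsGroup)

record Graph (n : ℕ) : Set where
  field
    adj     : Fin n → Fin n → Bool
    symm    : ∀ u v → adj u v ≡ adj v u
    irrefl  : ∀ v → adj v v ≡ false

open Graph public

Adj : ∀ {n} → Graph n → Fin n → Fin n → Set
Adj Γ u v = T (adj Γ u v)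

degree : ∀ {n} → Graph n → Fin n → ℕ
degree {n} Γ v = length (filterᵇ (adj Γ v) (allFin n))

Regular : ∀ {n} → Graph n → ℕ → Set
Regular Γ k = ∀ v → degree Γ v ≡ k

record FinGroup (m : ℕ) : Set where
  field
    _∙_     : Fin m → Fin m → Fin m
    ε       : Fin m
    _⁻¹     : Fin m → Fin m
    isGroup : IsGroup {A = Fin m} _≡_ _∙_ ε _⁻¹

open FinGroup public

SubsetG : ℕ → Set₁
SubsetG m = Fin m → Set

module _ {m : ℕ} (G : FinGroup m) where
  private
    _·_ = _∙_ G
    e   = ε G
    inv = _⁻¹ G

  IsSubgroup : SubsetG m → Set
  IsSubgroup H = H e
               × (∀ x y → H x → H y → H (x · y))
               × (∀ x → H x → H (inv x))

  Solvable : Set₁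
  Solvable = Σ ℕ λ r → Σ (ℕ → SubsetG m) λ H →
      (∀ i → i ≤ r → IsSubgroup (H i))
    × (∀ x → H 0 x)
    × (∀ x → H r x → x ≡ e)
    × (∀ i → i < r → ∀ x → H (Data.Nat.suc i) x → H i x)
    × (∀ i → i < r → ∀ x h → H i x → H (Data.Nat.suc i) h
                     → H (Data.Nat.suc i) ((x · h) · inv x))
    × (∀ i → i < r → ∀ x y → H i x → H i y
                     → H (Data.Nat.suc i) (((x · y) · inv x) · inv y))

record ActsByAutomorphisms {n m : ℕ} (G : FinGroup m) (Γ : Graph n) : Set where
  field
    act      : Fin n → Fin m → Fin n
    act-id   : ∀ α → act α (ε G) ≡ α
    act-comp : ∀ α g h → act (act α g) h ≡ act α (_∙_ G g h)
    act-adj  : ∀ α β g → adj Γ α β ≡ adj Γ (act α g) (act β g)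

open ActsByAutomorphisms public

ArcTransitive : ∀ {n m} {G : FinGroup m} {Γ : Graph n} → ActsByAutomorphisms G Γ → Set
ArcTransitive {n} {m} {G} {Γ} A =
    (∀ α β → ∃ λ g → act A α g ≡ β)
  × (∀ α β γ δ → Adj Γ α β → Adj Γ γ δ →
       ∃ λ g → (act A α g ≡ γ) × (act A β g ≡ δ))

sumℤ : List ℤ → ℤ
sumℤ = foldr ℤ._+_ 0ℤ

-- An orientation: o u v = true means the edge {u,v} is directed u → v
-- (tail u, head v); each edge receives exactly one direction.
IsOrientation : ∀ {n} → Graph n → (Fin n → Fin n → Bool) → Set
IsOrientation Γ o = ∀ u v → Adj Γ u v →
  (T (o u v) × ¬ T (o v u)) ⊎ (T (o v u) × ¬ T (o u v))

IsEdgeFunction : ∀ {n} → Graph n → (Fin n → Fin n → ℤ) → Set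
IsEdgeFunction Γ f = ∀ u v → Adj Γ u v → f u v ≡ f v u

InRange : ℕ → ℤ → Set
InRange k z = ℤ.∣ z ∣ < k

outSum : ∀ {n} → Graph n → (Fin n → Fin n → Bool) → (Fin n → Fin n → ℤ) → Fin n → ℤ
outSum {n} Γ o f v =
  sumℤ (map (λ w → if adj Γ v w ∧ o v w then f v w else 0ℤ) (allFin n))

inSum : ∀ {n} → Graph n → (Fin n → Fin n → Bool) → (Fin n → Fin n → ℤ) → Fin n → ℤ
inSum {n} Γ o f v =
  sumℤ (map (λ w → if adj Γ v w ∧ o w v then f w v else 0ℤ) (allFin n))

IsFlow : ∀ {n} → Graph n → ℕ → (Fin n → Fin n → Bool) → (Fin n → Fin n → ℤ) → Set
IsFlow Γ k o f =
    IsOrientation Γ o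
  × IsEdgeFunction Γ f
  × (∀ u v → Adj Γ u v → InRange k (f u v))
  × (∀ v → outSum Γ o f v ≡ inSum Γ o f v)

IsNowhereZero : ∀ {n} → Graph n → (Fin n → Fin n → ℤ) → Set
IsNowhereZero Γ f = ∀ u v → Adj Γ u v → ¬ (f u v ≡ 0ℤ)

HasNZFlow : ∀ {n} → Graph n → ℕ → Set
HasNZFlow {n} Γ k = Σ (Fin n → Fin n → Bool) λ o → Σ (Fin n → Fin n → ℤ) λ f →
  IsFlow Γ k o f × IsNowhereZero Γ f

{-# OPTIONS --safe #-}

-- A nowhere-zero 3-flow is an antisymmetric function on arcs with values ±1, ±2 and zero sum at every
-- vertex. If the valency k is even, an Eulerian orientation gives one. Let k be odd, and let N = D i,
-- M = D (i + 1) be the consecutive terms of the derived series of G such that a vertex has two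
-- neighbours in a common N-orbit but never in a common M-orbit.
--
-- If the edges join different N-orbits, the edges between two adjacent orbits form a regular
-- bipartite graph of valency at least 2; it splits into perfect matchings (König), which receive
-- weights ±1, ±2 of sum zero.
--
-- If the edges lie inside N-orbits, then modulo M the abelian group N / M acts on each of them, and the
-- neighbours of v are the v ◂ x for x in an inverse-closed set of k elements of N / M on which the
-- stabiliser of v in G is transitive. As k is odd, one and hence every such x is an involution. Three of
-- them a, b, c with c ≠ ab generate cubes, which are bipartite and take the weights 1, 1, -2; what remains
-- is regular of even valency k - 3, hence Eulerian. Everything is constructed on the graph itself, so no
-- quotient graph and no induction on the group is needed.
module Submission where

open import Defs
open import Algebra.Bundles using (Group)
import Algebra.Properties.AbelianGroup as AbelianGroupProperties
import Algebra.Properties.Group as GroupProperties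
import Algebra.Properties.Semiring.Sum as SemiringSum
open import Algebra.Structures using (IsGroup)
open import Data.Bool using (Bool; true; false; if_then_else_; _∧_; _∨_; not; T; T?)
import Data.Bool.Properties as Boolₚ
open import Data.Empty using (⊥-elim)
open import Data.Fin as Fin using (Fin; zero; suc; combine; remQuot; _↑ˡ_; _↑ʳ_)
open import Data.Fin.Permutation using (permutation)
import Data.Fin.Properties as Finₚ
open import Data.Fin.Subset using (Subset)
open import Data.Fin.Subset.Properties using (anySubset?)
open import Data.Integer as ℤ using (ℤ; +_; -_; 0ℤ; 1ℤ; -1ℤ; _+_; _*_; _-_)
import Data.Integer.Properties as ℤₚ
open import Data.Integer.Tactic.RingSolver using (solve-∀)
open import Data.List using (List; []; _∷_; length; filterᵇ; allFin; map; tabulate)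
import Data.List.Properties as Listₚ
open import Data.List.Relation.Unary.All using (All; []; _∷_)
open import Data.Nat as ℕ using (ℕ; zero; suc; _≤_)
import Data.Nat.DivMod as ℕ
import Data.Nat.Properties as ℕₚ
open import Data.Product using (Σ; ∃; _×_; _,_; proj₁; proj₂)
open import Data.Sum using (_⊎_; inj₁; inj₂)
import Data.Sum.Properties as Sumₚ
import Data.Vec as Vec
open import Data.Vec.Functional using (updateAt)
open import Data.Vec.Functional.Properties using (updateAt-updates; updateAt-minimal)
import Data.Vec.Properties as Vecₚ
open import Function using (_∘_; const; module Equivalence)
open import Level using (0ℓ)
open import Relation.Binary.Definitions using (DecidableEquality; tri<; tri≈; tri>)
open import Relation.Binary.PropositionalEquality
open import Relation.Binary.Structures using (IsDecEquivalence; IsEquivalence)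
open import Relation.Nullary using (¬_; Dec; yes; no; does)
open import Relation.Nullary.Decidable using (_⊎-dec_; _×-dec_; _→-dec_; ¬?; dec-true; dec-false; decidable-stable)

open AbelianGroupProperties ℤₚ.+-0-abelianGroup using (∙-cancelˡ)
open SemiringSum ℤₚ.+-*-semiring using (sum; sum-cong-≗; ∑-distrib-+; ∑-comm; sum-permute; *-distribˡ-sum)

-- Finite integer sums

⟦_⟧ : Bool → ℤ
⟦ true ⟧  = 1ℤ
⟦ false ⟧ = 0ℤ

sum-0 : ∀ {n} {f : Fin n → ℤ} → (∀ i → f i ≡ 0ℤ) → sum f ≡ 0ℤ
sum-0 {zero}  h = refl
sum-0 {suc n} h = cong₂ _+_ (h zero) (sum-0 (h ∘ suc))

sum-neg : ∀ {n} (f : Fin n → ℤ) → sum (λ i → - f i) ≡ - sum f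
sum-neg {zero}  f = refl
sum-neg {suc n} f = trans (cong (λ z → - f zero + z) (sum-neg (f ∘ suc)))
  (sym (ℤₚ.neg-distrib-+ (f zero) _))

sum-replace : ∀ {n} (i : Fin n) (f g : Fin n → ℤ) → (∀ j → j ≢ i → f j ≡ g j) →
  sum f ≡ sum g + (f i - g i)
sum-replace {suc n} zero f g h =
  trans (cong (λ z → f zero + z) (sum-cong-≗ (λ j → h (suc j) (λ ())))) (lem (f zero) (g zero) _)
  where
  lem : ∀ x y z → x + z ≡ y + z + (x - y)
  lem = solve-∀
sum-replace {suc n} (suc i) f g h =
  trans (cong₂ _+_ (h zero (λ ()))
    (sum-replace i (f ∘ suc) (g ∘ suc) (λ j j≢i → h (suc j) (j≢i ∘ Finₚ.suc-injective))))
  (sym (ℤₚ.+-assoc (g zero) _ _))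

sum-single : ∀ {n} (i : Fin n) (f : Fin n → ℤ) → (∀ j → j ≢ i → f j ≡ 0ℤ) → sum f ≡ f i
sum-single {n} i f h = trans (sum-replace i f (const 0ℤ) h)
  (trans (cong (_+ (f i - 0ℤ)) (sum-0 {n} (λ _ → refl))) (lem (f i)))
  where
  lem : ∀ x → 0ℤ + (x - 0ℤ) ≡ x
  lem = solve-∀

sum-combine : ∀ m n (f : Fin (m ℕ.* n) → ℤ) → sum f ≡ sum {m} (λ i → sum {n} (λ j → f (combine i j)))
sum-combine zero    n f = refl
sum-combine (suc m) n f =
  trans (sum-split n f) (cong (λ z → sum {n} (λ j → f (j ↑ˡ (m ℕ.* n))) + z) (sum-combine m n (λ k → f (n ↑ʳ k))))
  where
  sum-split : ∀ n {p} (f : Fin (n ℕ.+ p) → ℤ) →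
    sum f ≡ sum {n} (λ j → f (j ↑ˡ p)) + sum {p} (λ k → f (n ↑ʳ k))
  sum-split zero    f = sym (ℤₚ.+-identityˡ _)
  sum-split (suc n) f = trans (cong (λ z → f zero + z) (sum-split n (f ∘ suc))) (sym (ℤₚ.+-assoc (f zero) _ _))

-- Parity and signs

Even : ℤ → Set
Even z = ∃ λ q → z ≡ q + q

remaining-double : ∀ x y q → x + x + y ≡ q + q → y ≡ (q - x) + (q - x)
remaining-double x y q eq = trans (l x y) (trans (cong (_- (x + x)) eq) (r x q))
  where
  l : ∀ x y → y ≡ x + x + y - (x + x)
  l = solve-∀
  r : ∀ x q → q + q - (x + x) ≡ (q - x) + (q - x)
  r = solve-∀

1-odd : ¬ Even 1ℤ
1-odd (+ zero , ())
1-odd (+ suc zero , ())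
1-odd (+ suc (suc n) , ())
1-odd (ℤ.-[1+ n ] , ())

IsSign : ℤ → Set
IsSign z = z ≡ 1ℤ ⊎ z ≡ -1ℤ

-sign : ∀ {z} → IsSign z → IsSign (- z)
-sign (inj₁ refl) = inj₂ refl
-sign (inj₂ refl) = inj₁ refl

-- Eulerian orientations of multigraphs

module Eulerian {V : Set} (_≟_ : DecidableEquality V) where

  δ : V → V → ℤ
  δ u v = ⟦ does (u ≟ v) ⟧

  δ-refl : ∀ v → δ v v ≡ 1ℤ
  δ-refl v = cong ⟦_⟧ (dec-true (v ≟ v) refl)

  δ-≢ : ∀ {u v} → u ≢ v → δ u v ≡ 0ℤ
  δ-≢ {u} {v} u≢v = cong ⟦_⟧ (dec-false (u ≟ v) u≢v)

  -- A multigraph is a list of pairs: edge `i` joins `a i` and `b i`. Loops, which count twice here,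
  -- and parallel edges must be allowed because the induction below creates them.
  degreeAt : ∀ {N} → (a b : Fin N → V) → V → ℤ
  degreeAt a b v = sum λ i → δ (a i) v + δ (b i) v

  netFlow : ∀ {N} → (s : Fin N → ℤ) (a b : Fin N → V) → V → ℤ
  netFlow s a b v = sum λ i → s i * (δ (a i) v - δ (b i) v)

  EulerSigns : ∀ {N} → (a b : Fin N → V) → Set
  EulerSigns {N} a b =
    Σ (Fin N → ℤ) λ s → (∀ i → IsSign (s i)) × (∀ v → netFlow s a b v ≡ 0ℤ)

  private
    cons : ∀ {N} → ℤ → (Fin N → ℤ) → Fin (suc N) → ℤ
    cons z s zero    = z
    cons z s (suc i) = s i

    cons-sign : ∀ {N z} {s : Fin N → ℤ} → IsSign z → (∀ i → IsSign (s i)) → ∀ i → IsSign (cons z s i)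
    cons-sign p q zero    = p
    cons-sign p q (suc i) = q i

  -- Induction on the number of edges: a walk u – v – w through the first edge is
  -- replaced by a single edge u – w, whose direction orients both.
  eulerSigns : ∀ {N} (a b : Fin N → V) → (∀ v → Even (degreeAt a b v)) → EulerSigns a b
  eulerSigns {zero} a b even = (λ ()) , (λ ()) , λ v → refl
  eulerSigns {suc N} a b even with a zero ≟ b zero
  -- A loop contributes 2 to one degree and nothing to the net flow, so its sign is arbitrary.
  ... | yes a₀≡b₀ = let s , sgn , bal = eulerSigns (a ∘ suc) (b ∘ suc) even′ in
      cons 1ℤ s , cons-sign (inj₁ refl) sgn , λ v →
        trans (cong₂ (λ x y → 1ℤ * (x - δ (b zero) v) + y) (cong (λ u → δ u v) a₀≡b₀) (bal v))
              (lem₀ (δ (b zero) v))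
    where
    lem₀ : ∀ x → 1ℤ * (x - x) + 0ℤ ≡ 0ℤ
    lem₀ = solve-∀
    even′ : ∀ v → Even (degreeAt (a ∘ suc) (b ∘ suc) v)
    even′ v = let q , eq = even v in q - δ (b zero) v ,
      remaining-double (δ (b zero) v) _ q
        (trans (cong (λ u → δ u v + δ (b zero) v + degreeAt (a ∘ suc) (b ∘ suc) v) (sym a₀≡b₀)) eq)
  ... | no a₀≢b₀ with Finₚ.any? (λ i → (a (suc i) ≟ b zero) ⊎-dec (b (suc i) ≟ b zero))
  -- The first edge is no loop and no other edge meets `b zero`, which would thus have degree 1.
  ...   | no none = ⊥-elim (1-odd (subst Even deg≡1 (even (b zero))))
    where
    deg≡1 : degreeAt a b (b zero) ≡ 1ℤ
    deg≡1 = cong₂ _+_ (cong₂ _+_ (δ-≢ a₀≢b₀) (δ-refl (b zero)))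
      (sum-0 λ i → cong₂ _+_ (δ-≢ (λ eq → none (i , inj₁ eq))) (δ-≢ (λ eq → none (i , inj₂ eq))))
  ...   | yes (i , inj₁ aᵢ≡b₀) = let s , sgn , bal = eulerSigns a′ (b ∘ suc) even′ in
      cons (s i) s , cons-sign (sgn i) sgn , λ v →
        trans (lemF (s i) (δ (a zero) v) (δ (b zero) v) (δ (b (suc i)) v) _ (net s v)) (bal v)
    where
    a′ : Fin N → V
    a′ = updateAt (a ∘ suc) i (const (a zero))
    a′-same : ∀ j → j ≢ i → a′ j ≡ a (suc j)
    a′-same j j≢i = updateAt-minimal j i (a ∘ suc) j≢i
    a′ᵢ : a′ i ≡ a zero
    a′ᵢ = updateAt-updates i (a ∘ suc)
    deg : ∀ v → degreeAt a′ (b ∘ suc) v ≡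
      degreeAt (a ∘ suc) (b ∘ suc) v + ((δ (a zero) v + δ (b (suc i)) v) - (δ (b zero) v + δ (b (suc i)) v))
    deg v = trans (sum-replace i _ _ (λ j j≢i → cong (λ u → δ u v + δ (b (suc j)) v) (a′-same j j≢i)))
      (cong₂ (λ x y → degreeAt (a ∘ suc) (b ∘ suc) v + ((δ x v + δ (b (suc i)) v) - (δ y v + δ (b (suc i)) v)))
        a′ᵢ aᵢ≡b₀)
    even′ : ∀ v → Even (degreeAt a′ (b ∘ suc) v)
    even′ v = let q , eq = even v in q - δ (b zero) v ,
      trans (deg v) (lemD (δ (a zero) v) (δ (b zero) v) (δ (b (suc i)) v) _ q eq)
      where
      lemD : ∀ x y z d q → x + y + d ≡ q + q → d + ((x + z) - (y + z)) ≡ (q - y) + (q - y)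
      lemD x y z d q eq = trans (l x y z d) (trans (cong (_- (y + y)) eq) (r y q))
        where
        l : ∀ x y z d → d + ((x + z) - (y + z)) ≡ x + y + d - (y + y)
        l = solve-∀
        r : ∀ y q → q + q - (y + y) ≡ (q - y) + (q - y)
        r = solve-∀
    net : ∀ s v → netFlow s a′ (b ∘ suc) v ≡ netFlow s (a ∘ suc) (b ∘ suc) v +
      (s i * (δ (a zero) v - δ (b (suc i)) v) - s i * (δ (b zero) v - δ (b (suc i)) v))
    net s v = trans (sum-replace i _ _ (λ j j≢i → cong (λ u → s j * (δ u v - δ (b (suc j)) v)) (a′-same j j≢i)))
      (cong₂ (λ x y → netFlow s (a ∘ suc) (b ∘ suc) v +
        (s i * (δ x v - δ (b (suc i)) v) - s i * (δ y v - δ (b (suc i)) v))) a′ᵢ aᵢ≡b₀)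
    lemF : ∀ σ x y z {f′} f → f′ ≡ f + (σ * (x - z) - σ * (y - z)) → σ * (x - y) + f ≡ f′
    lemF σ x y z f eq = trans (l σ x y z f) (sym eq)
      where
      l : ∀ σ x y z f → σ * (x - y) + f ≡ f + (σ * (x - z) - σ * (y - z))
      l = solve-∀
  -- Edge `i` is stored as ending at `b zero`, so the walk along it continues through the first edge
  -- against the stored direction; hence the opposite sign.
  ...   | yes (i , inj₂ bᵢ≡b₀) = let s , sgn , bal = eulerSigns (a ∘ suc) b′ even′ in
      cons (- s i) s , cons-sign (-sign (sgn i)) sgn , λ v →
        trans (lemF (s i) (δ (a zero) v) (δ (b zero) v) (δ (a (suc i)) v) _ (net s v)) (bal v)
    where
    b′ : Fin N → V
    b′ = updateAt (b ∘ suc) i (const (a zero))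
    b′-same : ∀ j → j ≢ i → b′ j ≡ b (suc j)
    b′-same j j≢i = updateAt-minimal j i (b ∘ suc) j≢i
    b′ᵢ : b′ i ≡ a zero
    b′ᵢ = updateAt-updates i (b ∘ suc)
    deg : ∀ v → degreeAt (a ∘ suc) b′ v ≡
      degreeAt (a ∘ suc) (b ∘ suc) v + ((δ (a (suc i)) v + δ (a zero) v) - (δ (a (suc i)) v + δ (b zero) v))
    deg v = trans (sum-replace i _ _ (λ j j≢i → cong (λ u → δ (a (suc j)) v + δ u v) (b′-same j j≢i)))
      (cong₂ (λ x y → degreeAt (a ∘ suc) (b ∘ suc) v + ((δ (a (suc i)) v + δ x v) - (δ (a (suc i)) v + δ y v)))
        b′ᵢ bᵢ≡b₀)
    even′ : ∀ v → Even (degreeAt (a ∘ suc) b′ v)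
    even′ v = let q , eq = even v in q - δ (b zero) v ,
      trans (deg v) (lemD (δ (a zero) v) (δ (b zero) v) (δ (a (suc i)) v) _ q eq)
      where
      lemD : ∀ x y z d q → x + y + d ≡ q + q → d + ((z + x) - (z + y)) ≡ (q - y) + (q - y)
      lemD x y z d q eq = trans (l x y z d) (trans (cong (_- (y + y)) eq) (r y q))
        where
        l : ∀ x y z d → d + ((z + x) - (z + y)) ≡ x + y + d - (y + y)
        l = solve-∀
        r : ∀ y q → q + q - (y + y) ≡ (q - y) + (q - y)
        r = solve-∀
    net : ∀ s v → netFlow s (a ∘ suc) b′ v ≡ netFlow s (a ∘ suc) (b ∘ suc) v +
      (s i * (δ (a (suc i)) v - δ (a zero) v) - s i * (δ (a (suc i)) v - δ (b zero) v))
    net s v = trans (sum-replace i _ _ (λ j j≢i → cong (λ u → s j * (δ (a (suc j)) v - δ u v)) (b′-same j j≢i)))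
      (cong₂ (λ x y → netFlow s (a ∘ suc) (b ∘ suc) v +
        (s i * (δ (a (suc i)) v - δ x v) - s i * (δ (a (suc i)) v - δ y v))) b′ᵢ bᵢ≡b₀)
    lemF : ∀ σ x y z {f′} f → f′ ≡ f + (σ * (z - x) - σ * (z - y)) → - σ * (x - y) + f ≡ f′
    lemF σ x y z f eq = trans (l σ x y z f) (sym eq)
      where
      l : ∀ σ x y z f → - σ * (x - y) + f ≡ f + (σ * (z - x) - σ * (z - y))
      l = solve-∀

-- Eulerian signs for edges given by a Boolean matrix

sum₂ : ∀ {n} → (Fin n → Fin n → ℤ) → ℤ
sum₂ {n} f = sum {n} λ u → sum {n} (f u)

sum₂-cong : ∀ {n} {f g : Fin n → Fin n → ℤ} → (∀ u w → f u w ≡ g u w) → sum₂ f ≡ sum₂ g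
sum₂-cong h = sum-cong-≗ (λ u → sum-cong-≗ (h u))

sum₂-+ : ∀ {n} (f g : Fin n → Fin n → ℤ) → sum₂ (λ u w → f u w + g u w) ≡ sum₂ f + sum₂ g
sum₂-+ {n} f g = trans (sum-cong-≗ {n} (λ u → ∑-distrib-+ (f u) (g u)))
  (∑-distrib-+ {n} (λ u → sum {n} (f u)) (λ u → sum {n} (g u)))

sum-minus : ∀ {n} (f g : Fin n → ℤ) → sum (λ i → f i - g i) ≡ sum f - sum g
sum-minus {n} f g = trans (∑-distrib-+ {n} f (λ i → - g i)) (cong (λ z → sum f + z) (sum-neg g))

sum₂-minus : ∀ {n} (f g : Fin n → Fin n → ℤ) → sum₂ (λ u w → f u w - g u w) ≡ sum₂ f - sum₂ g
sum₂-minus {n} f g = trans (sum-cong-≗ {n} (λ u → sum-minus (f u) (g u)))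
  (sum-minus {n} (λ u → sum {n} (f u)) (λ u → sum {n} (g u)))

module _ {V : Set} (_≟_ : DecidableEquality V) where
  open Eulerian _≟_

  module _ {n : ℕ} (l : Fin n → V) (r : Fin n → V) (E : Fin n → Fin n → Bool) where

    private
      end : Fin n × Fin n → V
      end (u , w) = if E u w then r w else l u

      src tgt : Fin (n ℕ.* n) → V
      src k = l (proj₁ (remQuot n k))
      tgt k = end (remQuot n k)

      -- A non-edge becomes a loop, which affects neither parities nor net flow.
      δ-src : ∀ u w v → δ (src (combine u w)) v ≡ δ (l u) v
      δ-src u w v = cong (λ p → δ (l (proj₁ p)) v) (Finₚ.remQuot-combine u w)

      δ-tgt : ∀ u w v → δ (tgt (combine u w)) v ≡ δ (l u) v + ⟦ E u w ⟧ * (δ (r w) v - δ (l u) v)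
      δ-tgt u w v = trans (cong (λ p → δ (end p) v) (Finₚ.remQuot-combine u w)) (δ-end u w v)
        where
        δ-end : ∀ u w v → δ (end (u , w)) v ≡ δ (l u) v + ⟦ E u w ⟧ * (δ (r w) v - δ (l u) v)
        δ-end u w v with E u w
        ... | true  = lem (δ (l u) v) (δ (r w) v)
          where
          lem : ∀ x y → y ≡ x + 1ℤ * (y - x)
          lem = solve-∀
        ... | false = lem (δ (l u) v) (δ (r w) v)
          where
          lem : ∀ x y → x ≡ x + 0ℤ * (y - x)
          lem = solve-∀

    abstract
      -- The entry `(u , w)` of `E` stands for an edge from `l u` to `r w`. Two vertex maps serve
      -- two readings: identities for a graph whose edges are listed once, and the two injections
      -- for the bipartite graph of rows and columns.
      matrixSigns : (∀ v → Even (sum₂ λ u w → ⟦ E u w ⟧ * δ (l u) v + ⟦ E u w ⟧ * δ (r w) v)) →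
        Σ (Fin n → Fin n → ℤ) λ s → (∀ u w → IsSign (s u w)) ×
          (∀ v → sum₂ (λ u w → s u w * ⟦ E u w ⟧ * δ (l u) v - s u w * ⟦ E u w ⟧ * δ (r w) v) ≡ 0ℤ)
      matrixSigns even =
        let s , sgn , bal = eulerSigns src tgt even′ in
        (λ u w → s (combine u w)) , (λ u w → sgn (combine u w)) , λ v →
          trans (sum₂-cong {n} λ u w → trans (netTerm (s (combine u w)) ⟦ E u w ⟧ (δ (l u) v) (δ (r w) v))
              (cong₂ (λ x y → s (combine u w) * (x - y)) (sym (δ-src u w v)) (sym (δ-tgt u w v))))
            (trans (sym (sum-combine n n _)) (bal v))
        where
        netTerm : ∀ s e x y → s * e * x - s * e * y ≡ s * (x - (x + e * (y - x)))
        netTerm = solve-∀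
        degTerm : ∀ e x y → x + (x + e * (y - x)) ≡ ((x - e * x) + (x - e * x)) + (e * x + e * y)
        degTerm = solve-∀
        -- The number of padding loops at a vertex; each adds 2 to the degree there.
        loops : V → ℤ
        loops v = sum₂ {n} λ u w → δ (l u) v - ⟦ E u w ⟧ * δ (l u) v
        even′ : ∀ v → Even (degreeAt src tgt v)
        even′ v = let q , eq = even v in loops v + q ,
          trans (sum-combine n n _)
          (trans (sum₂-cong {n} λ u w → trans (cong₂ _+_ (δ-src u w v) (δ-tgt u w v))
                   (degTerm ⟦ E u w ⟧ (δ (l u) v) (δ (r w) v)))
          (trans (sum₂-+ {n} _ _)
          (trans (cong₂ _+_ (sum₂-+ {n} _ _) eq) (lem (loops v) q))))
          where
          lem : ∀ x q → (x + x) + (q + q) ≡ (x + q) + (x + q)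
          lem = solve-∀

module _ {n : ℕ} where
  open Eulerian (Finₚ._≟_ {n}) using (δ; δ-refl; δ-≢)

  sum-*δ : (g : Fin n → ℤ) (v : Fin n) → sum (λ u → g u * δ u v) ≡ g v
  sum-*δ g v = trans (sum-single v _ λ j j≢v → trans (cong (g j *_) (δ-≢ j≢v)) (ℤₚ.*-zeroʳ (g j)))
    (trans (cong (g v *_) (δ-refl v)) (ℤₚ.*-identityʳ (g v)))

  sum₂-*δˡ : (g : Fin n → Fin n → ℤ) (v : Fin n) → sum₂ (λ u w → g u w * δ u v) ≡ sum (g v)
  sum₂-*δˡ g v = trans (∑-comm {n} {n} _) (sum-cong-≗ {n} (λ w → sum-*δ (λ u → g u w) v))

  sum₂-*δʳ : (g : Fin n → Fin n → ℤ) (v : Fin n) → sum₂ (λ u w → g u w * δ w v) ≡ sum (λ u → g u v)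
  sum₂-*δʳ g v = sum-cong-≗ {n} (λ u → sum-*δ (g u) v)

-- Balanced functions, and graphs with even degrees

Small : ℤ → Set
Small z = z ≢ 0ℤ × ℤ.∣ z ∣ ℕ.< 3

sign⇒small : ∀ {z} → IsSign z → Small z
sign⇒small (inj₁ refl) = (λ ()) , ℕ.s≤s (ℕ.s≤s ℕ.z≤n)
sign⇒small (inj₂ refl) = (λ ()) , ℕ.s≤s (ℕ.s≤s ℕ.z≤n)

-- Stated for any adjacency matrix `X`, since in the odd case a subgraph is balanced separately and
-- the result is added to a flow on the remaining edges.
record Balanced {n : ℕ} (X : Fin n → Fin n → Bool) (F : Fin n → Fin n → ℤ) : Set where
  field
    off      : ∀ u v → X u v ≡ false → F u v ≡ 0ℤ
    small    : ∀ u v → X u v ≡ true → Small (F u v)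
    antisym  : ∀ u v → F v u ≡ - F u v
    balanced : ∀ v → sum (F v) ≡ 0ℤ

module _ {n : ℕ} (X : Fin n → Fin n → Bool)
         (X-sym : ∀ u v → X u v ≡ X v u) (X-irrefl : ∀ v → X v v ≡ false)
         (X-even : ∀ v → Even (sum λ w → ⟦ X v w ⟧)) where

  open Eulerian (Finₚ._≟_ {n}) using (δ)

  private
    E : Fin n → Fin n → Bool
    E u w = X u w ∧ does (u Finₚ.<? w)

    E-false : ∀ u w → ¬ (u Fin.< w) → E u w ≡ false
    E-false u w u≮w rewrite dec-false (u Finₚ.<? w) u≮w with X u w
    ... | true  = refl
    ... | false = refl

    E-true : ∀ u w → u Fin.< w → E u w ≡ X u w
    E-true u w u<w rewrite dec-true (u Finₚ.<? w) u<w with X u w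
    ... | true  = refl
    ... | false = refl

    split : ∀ u w → ⟦ X u w ⟧ ≡ ⟦ E u w ⟧ + ⟦ E w u ⟧
    split u w with Finₚ.<-cmp u w
    ... | tri< u<w _ w≮u rewrite E-true u w u<w | E-false w u w≮u = sym (ℤₚ.+-identityʳ _)
    ... | tri≈ _ refl _ rewrite X-irrefl u = refl
    ... | tri> u≮w _ w<u rewrite E-true w u w<u | E-false u w u≮w | X-sym u w = sym (ℤₚ.+-identityˡ _)

    e : Fin n → Fin n → ℤ
    e u w = ⟦ E u w ⟧

    evenDeg : ∀ v → Even (sum₂ λ u w → ⟦ E u w ⟧ * δ u v + ⟦ E u w ⟧ * δ w v)
    evenDeg v = let q , eq = X-even v in q ,
      trans (sum₂-+ {n} (λ u w → e u w * δ u v) (λ u w → e u w * δ w v))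
        (trans (cong₂ _+_ (sum₂-*δˡ e v) (sum₂-*δʳ e v))
        (trans (sym (∑-distrib-+ {n} (e v) (λ u → e u v))) (trans (sum-cong-≗ {n} (λ w → sym (split v w))) eq)))

  private
   module _ (s : Fin n → Fin n → ℤ) (sgn : ∀ u w → IsSign (s u w))
     (bal : ∀ v → sum₂ (λ u w → s u w * e u w * δ u v - s u w * e u w * δ w v) ≡ 0ℤ) where
    F : Fin n → Fin n → ℤ
    F v w = s v w * ⟦ E v w ⟧ - s w v * ⟦ E w v ⟧
    antisym : ∀ u v → F v u ≡ - F u v
    antisym u v = lem (s v u * ⟦ E v u ⟧) (s u v * ⟦ E u v ⟧)
      where
      lem : ∀ x y → x - y ≡ - (y - x)
      lem = solve-∀
    zeros : ∀ x y → x * 0ℤ - y * 0ℤ ≡ 0ℤ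
    zeros = solve-∀
    onlyˡ : ∀ x y → x ≡ x * 1ℤ - y * 0ℤ
    onlyˡ = solve-∀
    onlyʳ : ∀ x y → - y ≡ x * 0ℤ - y * 1ℤ
    onlyʳ = solve-∀
    off : ∀ u v → X u v ≡ false → F u v ≡ 0ℤ
    off u v eq rewrite sym (X-sym u v) | eq = zeros (s u v) (s v u)
    small : ∀ u v → X u v ≡ true → Small (F u v)
    small u v eq with Finₚ.<-cmp u v
    ... | tri< u<v _ v≮u rewrite E-true u v u<v | E-false v u v≮u | eq =
      subst Small (onlyˡ (s u v) (s v u)) (sign⇒small (sgn u v))
    ... | tri≈ _ refl _ = ⊥-elim (absurd (trans (sym eq) (X-irrefl u)))
      where
      absurd : true ≢ false
      absurd ()
    ... | tri> u≮v _ v<u rewrite E-false u v u≮v | E-true v u v<u | sym (X-sym u v) | eq =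
      subst Small (onlyʳ (s u v) (s v u)) (sign⇒small (-sign (sgn v u)))
    balanced : ∀ v → sum (F v) ≡ 0ℤ
    balanced v = trans (sum-minus {n} (g v) (λ w → g w v)) (trans (sym (cong₂ _-_ (sum₂-*δˡ g v) (sum₂-*δʳ g v)))
      (trans (sym (sum₂-minus {n} (λ u w → g u w * δ u v) (λ u w → g u w * δ w v))) (bal v)))
      where
      g : Fin n → Fin n → ℤ
      g u w = s u w * ⟦ E u w ⟧

  abstract
    -- An Eulerian orientation sends one unit along each edge. Every edge is listed once, from its
    -- smaller end, and `F` is made antisymmetric afterwards.
    eulerian : ∃ (Balanced X)
    eulerian = let s , sgn , bal = matrixSigns Finₚ._≟_ (λ v → v) (λ v → v) E evenDeg in
      F s sgn bal , record { off = off s sgn bal ; small = small s sgn bal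
                           ; antisym = antisym s sgn bal ; balanced = balanced s sgn bal }

-- Sign matrices with vanishing line sums

module _ {n : ℕ} (X : Fin n → Fin n → Bool)
         (row-even : ∀ v → Even (sum λ w → ⟦ X v w ⟧))
         (col-even : ∀ w → Even (sum λ v → ⟦ X v w ⟧)) where

  private
    _≟₂_ : DecidableEquality (Fin n ⊎ Fin n)
    _≟₂_ = Sumₚ.≡-dec Finₚ._≟_ Finₚ._≟_

    open Eulerian _≟₂_ using (δ)
    module D = Eulerian (Finₚ._≟_ {n})

    δ₁₁ : ∀ u v → δ (inj₁ u) (inj₁ v) ≡ D.δ u v
    δ₁₁ u v with u Finₚ.≟ v
    ... | yes _ = refl
    ... | no _  = refl

    δ₂₂ : ∀ u v → δ (inj₂ u) (inj₂ v) ≡ D.δ u v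
    δ₂₂ u v with u Finₚ.≟ v
    ... | yes _ = refl
    ... | no _  = refl

    at-row : (g h : Fin n → Fin n → ℤ) → ∀ v →
      sum₂ (λ u w → g u w * δ (inj₁ u) (inj₁ v) + h u w * δ (inj₂ w) (inj₁ v)) ≡ sum (g v)
    at-row g h v = trans (sum₂-cong {n} λ u w → trans
        (cong₂ (λ x y → g u w * x + y) (δ₁₁ u v) (ℤₚ.*-zeroʳ (h u w))) (ℤₚ.+-identityʳ _))
      (sum₂-*δˡ g v)

    at-col : (g h : Fin n → Fin n → ℤ) → ∀ v →
      sum₂ (λ u w → g u w * δ (inj₁ u) (inj₂ v) + h u w * δ (inj₂ w) (inj₂ v)) ≡ sum (λ u → h u v)
    at-col g h v = trans (sum₂-cong {n} λ u w → trans
        (cong₂ (λ x y → x + h u w * y) (ℤₚ.*-zeroʳ (g u w)) (δ₂₂ w v)) (ℤₚ.+-identityˡ _))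
      (sum₂-*δʳ h v)

  -- In an Eulerian orientation of the bipartite graph of rows and columns, the sign of an entry
  -- tells whether its edge leaves the row or enters it.
  signMatrix : Σ (Fin n → Fin n → ℤ) λ s → (∀ u w → IsSign (s u w)) ×
    (∀ v → sum (λ w → s v w * ⟦ X v w ⟧) ≡ 0ℤ) × (∀ w → sum (λ v → s v w * ⟦ X v w ⟧) ≡ 0ℤ)
  signMatrix = s , proj₁ (proj₂ signs) ,
      (λ v → trans (sym (at-row g h v)) (trans (eq (inj₁ v)) (bal (inj₁ v)))) ,
      -- At a column the edges count with the opposite sign, so the balance there is minus the
      -- column sum.
      (λ v → ℤₚ.neg-injective (trans (sym (sum-neg {n} (λ u → g u v)))
               (trans (sym (at-col g h v)) (trans (eq (inj₂ v)) (bal (inj₂ v))))))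
    where
    e : Fin n → Fin n → ℤ
    e u w = ⟦ X u w ⟧
    even : ∀ v → Even (sum₂ λ u w → e u w * δ (inj₁ u) v + e u w * δ (inj₂ w) v)
    even (inj₁ v) = subst Even (sym (at-row e e v)) (row-even v)
    even (inj₂ v) = subst Even (sym (at-col e e v)) (col-even v)
    signs = matrixSigns _≟₂_ inj₁ inj₂ X even
    s : Fin n → Fin n → ℤ
    s = proj₁ signs
    bal = proj₂ (proj₂ signs)
    g h : Fin n → Fin n → ℤ
    g u w = s u w * ⟦ X u w ⟧
    h u w = - g u w
    eq : ∀ v → sum₂ (λ u w → g u w * δ (inj₁ u) v + h u w * δ (inj₂ w) v) ≡
               sum₂ (λ u w → g u w * δ (inj₁ u) v - g u w * δ (inj₂ w) v)
    eq v = sum₂-cong {n} λ u w → cong (λ z → g u w * δ (inj₁ u) v + z)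
      (sym (ℤₚ.neg-distribˡ-* (g u w) _))

-- Order of sums, and halving of matrices over the natural numbers

∥_∥ : Bool → ℕ
∥ true ∥  = 1
∥ false ∥ = 0

⟦⟧≡+∥∥ : ∀ b → ⟦ b ⟧ ≡ + ∥ b ∥
⟦⟧≡+∥∥ true  = refl
⟦⟧≡+∥∥ false = refl

sum-mono-≤ : ∀ {n} {f g : Fin n → ℤ} → (∀ i → f i ℤ.≤ g i) → sum f ℤ.≤ sum g
sum-mono-≤ {zero}  h = ℤₚ.≤-refl
sum-mono-≤ {suc n} h = ℤₚ.+-mono-≤ (h zero) (sum-mono-≤ {n} (h ∘ suc))

sum-const : ∀ n c → sum {n} (const (+ c)) ≡ + (n ℕ.* c)
sum-const zero    c = refl
sum-const (suc n) c = cong (λ z → + c + z) (sum-const n c)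

sum-nonneg : ∀ {n} {f : Fin n → ℤ} → (∀ i → 0ℤ ℤ.≤ f i) → 0ℤ ℤ.≤ sum f
sum-nonneg {zero}  h = ℤₚ.≤-refl
sum-nonneg {suc n} h = ℤₚ.+-mono-≤ (h zero) (sum-nonneg {n} (h ∘ suc))

term≤sum : ∀ {n} {f : Fin n → ℤ} → (∀ i → 0ℤ ℤ.≤ f i) → ∀ i → f i ℤ.≤ sum f
term≤sum {suc n} {f} h zero =
  subst (ℤ._≤ sum f) (ℤₚ.+-identityʳ (f zero)) (ℤₚ.+-monoʳ-≤ (f zero) (sum-nonneg {n} (h ∘ suc)))
term≤sum {suc n} {f} h (suc i) =
  subst (ℤ._≤ sum f) (ℤₚ.+-identityˡ (f (suc i))) (ℤₚ.+-mono-≤ (h zero) (term≤sum {n} (h ∘ suc) i))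

+-nonneg : ∀ k → 0ℤ ℤ.≤ + k
+-nonneg k = ℤ.+≤+ ℕ.z≤n

⟦⟧-nonneg : ∀ b → 0ℤ ℤ.≤ ⟦ b ⟧
⟦⟧-nonneg b = subst (0ℤ ℤ.≤_) (sym (⟦⟧≡+∥∥ b)) (+-nonneg _)

double-injective : ∀ {x y} → x + x ≡ y + y → x ≡ y
double-injective {x} {y} eq = ℤₚ.*-cancelˡ-≡ (+ 2) x y (trans (two x) (trans eq (sym (two y))))
  where
  two : ∀ z → + 2 * z ≡ z + z
  two = solve-∀

odd? : ℕ → Bool
odd? zero          = false
odd? (suc zero)    = true
odd? (suc (suc n)) = odd? n

half-odd : ∀ w → w ≡ ℕ.⌊ w /2⌋ ℕ.+ ℕ.⌊ w /2⌋ ℕ.+ ∥ odd? w ∥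
half-odd zero          = refl
half-odd (suc zero)    = refl
half-odd (suc (suc w)) = cong suc (trans (cong suc (half-odd w))
  (cong (ℕ._+ ∥ odd? w ∥) (sym (ℕₚ.+-suc ℕ.⌊ w /2⌋ ℕ.⌊ w /2⌋))))

half-oddℤ : ∀ w → + w ≡ (+ ℕ.⌊ w /2⌋ + + ℕ.⌊ w /2⌋) + ⟦ odd? w ⟧
half-oddℤ w = trans (cong +_ (half-odd w)) (cong (λ z → (+ ℕ.⌊ w /2⌋ + + ℕ.⌊ w /2⌋) + z) (sym (⟦⟧≡+∥∥ (odd? w))))

-- The sign `s` decides which half of an odd `w` is rounded up. Describing the halves by their
-- doubles avoids division.
record SignedHalves (w : ℕ) (s : ℤ) : Set where
  field
    h₁ h₂ : ℕ
    total : + h₁ + + h₂ ≡ + w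
    twice₁ : + h₁ + + h₁ ≡ + w + s * ⟦ odd? w ⟧
    twice₂ : + h₂ + + h₂ ≡ + w - s * ⟦ odd? w ⟧

signedHalves : ∀ w {s} → IsSign s → SignedHalves w s
signedHalves w {s} sgn = go (odd? w) refl sgn
  where
  h = ℕ.⌊ w /2⌋
  go : ∀ b → odd? w ≡ b → IsSign s → SignedHalves w s
  go false eq _ = record
    { h₁ = h ; h₂ = h ; total = sym w≡
    ; twice₁ = trans (sym w≡) (lem₁ (+ w)) ; twice₂ = trans (sym w≡) (lem₂ (+ w)) }
    where
    w≡ : + w ≡ + h + + h
    w≡ = trans (half-oddℤ w) (trans (cong (λ b → + h + + h + ⟦ b ⟧) eq) (ℤₚ.+-identityʳ _))
    lem₁ : ∀ x → x ≡ x + s * ⟦ odd? w ⟧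
    lem₁ x rewrite eq = sym (trans (cong (λ z → x + z) (ℤₚ.*-zeroʳ s)) (ℤₚ.+-identityʳ x))
    lem₂ : ∀ x → x ≡ x - s * ⟦ odd? w ⟧
    lem₂ x rewrite eq = sym (trans (cong (λ z → x - z) (ℤₚ.*-zeroʳ s)) (ℤₚ.+-identityʳ x))
  go true eq s± = res s±
    where
    w≡ : + w ≡ + h + + h + 1ℤ
    w≡ = trans (half-oddℤ w) (cong (λ b → + h + + h + ⟦ b ⟧) eq)
    tot₁ : ∀ x → (1ℤ + x) + x ≡ x + x + 1ℤ
    tot₁ = solve-∀
    tot₂ : ∀ x → x + (1ℤ + x) ≡ x + x + 1ℤ
    tot₂ = solve-∀
    big : ∀ x → (1ℤ + x) + (1ℤ + x) ≡ x + x + 1ℤ + 1ℤ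
    big = solve-∀
    little : ∀ x → x + x ≡ x + x + 1ℤ + -1ℤ
    little = solve-∀
    use : ∀ {z c} d → z ≡ + h + + h + 1ℤ + c → d * 1ℤ ≡ c → z ≡ + w + d * ⟦ odd? w ⟧
    use {z} d p q = trans p (cong₂ _+_ (sym w≡) (trans (sym q) (cong (λ b → d * ⟦ b ⟧) (sym eq))))
    use′ : ∀ {z c} d → z ≡ + h + + h + 1ℤ + c → - (d * 1ℤ) ≡ c → z ≡ + w - d * ⟦ odd? w ⟧
    use′ {z} d p q = trans p (cong₂ _+_ (sym w≡) (trans (sym q) (cong (λ b → - (d * ⟦ b ⟧)) (sym eq))))
    res : IsSign s → SignedHalves w s
    res (inj₁ refl) = record { h₁ = suc h ; h₂ = h ; total = trans (tot₁ (+ h)) (sym w≡)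
      ; twice₁ = use 1ℤ (big (+ h)) refl ; twice₂ = use′ 1ℤ (little (+ h)) refl }
    res (inj₂ refl) = record { h₁ = h ; h₂ = suc h ; total = trans (tot₂ (+ h)) (sym w≡)
      ; twice₁ = use -1ℤ (little (+ h)) refl ; twice₂ = use′ -1ℤ (big (+ h)) refl }

row col : ∀ {n} → (Fin n → Fin n → ℕ) → Fin n → ℤ
row {n} W v = sum {n} λ w → + W v w
col {n} W w = sum {n} λ v → + W v w

trace : ∀ {n} → (Fin n → Fin n → ℕ) → ℤ
trace {n} W = sum {n} λ v → + W v v

record Halving {n} (W : Fin n → Fin n → ℕ) (r c : Fin n → ℤ) : Set where
  field
    W₁ W₂ : Fin n → Fin n → ℕ
    total : ∀ v w → + W₁ v w + + W₂ v w ≡ + W v w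
    row₁  : ∀ v → row W₁ v ≡ r v
    row₂  : ∀ v → row W₂ v ≡ r v
    col₁  : ∀ v → col W₁ v ≡ c v
    col₂  : ∀ v → col W₂ v ≡ c v

module _ {n} (W : Fin n → Fin n → ℕ) (r c : Fin n → ℤ)
         (rows : ∀ v → row W v ≡ r v + r v) (cols : ∀ v → col W v ≡ c v + c v) where

  private
    x : Fin n → Fin n → ℤ
    x v w = ⟦ odd? (W v w) ⟧
    evenSum : ∀ {q} (f : Fin n → ℕ) → sum {n} (λ i → + f i) ≡ q + q → Even (sum {n} λ i → ⟦ odd? (f i) ⟧)
    evenSum {q} f eq = q - hs ,
      remaining-double hs _ q (trans (cong (λ z → z + odds) (sym (∑-distrib-+ {n} (λ i → + ℕ.⌊ f i /2⌋) (λ i → + ℕ.⌊ f i /2⌋))))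
        (trans (sym (∑-distrib-+ {n} (λ i → + ℕ.⌊ f i /2⌋ + + ℕ.⌊ f i /2⌋) (λ i → ⟦ odd? (f i) ⟧)))
          (trans (sum-cong-≗ {n} (λ i → sym (half-oddℤ (f i)))) eq)))
      where
      hs = sum {n} λ i → + ℕ.⌊ f i /2⌋
      odds = sum {n} λ i → ⟦ odd? (f i) ⟧
    signs = signMatrix (λ v w → odd? (W v w)) (λ v → evenSum {r v} (W v) (rows v)) (λ w → evenSum {c w} (λ v → W v w) (cols w))
    s = proj₁ signs
    s-row = proj₁ (proj₂ (proj₂ signs))
    s-col = proj₂ (proj₂ (proj₂ signs))
    H : ∀ v w → SignedHalves (W v w) (s v w)
    H v w = signedHalves (W v w) (proj₁ (proj₂ signs) v w)
    neg0 : (f : Fin n → ℤ) → sum f ≡ 0ℤ → sum (λ i → - f i) ≡ 0ℤ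
    neg0 f eq = trans (sum-neg {n} f) (cong -_ eq)
    halfSum : ∀ {q} (f g h : Fin n → ℤ) → (∀ i → h i + h i ≡ f i + g i) → sum f ≡ q + q → sum g ≡ 0ℤ → sum h ≡ q
    halfSum {q} f g h twice sf sg = double-injective (trans (sym (∑-distrib-+ {n} h h))
      (trans (sum-cong-≗ {n} twice) (trans (∑-distrib-+ {n} f g) (trans (cong₂ _+_ sf sg) (ℤₚ.+-identityʳ _)))))

  abstract
    -- The odd entries form a Boolean matrix with even line sums. Rounding them according to its
    -- sign matrix makes the rounding errors cancel along every row and column.
    halve : Halving W r c
    halve = record
      { W₁ = λ v w → SignedHalves.h₁ (H v w) ; W₂ = λ v w → SignedHalves.h₂ (H v w) ; total = λ v w → SignedHalves.total (H v w)
      ; row₁ = λ v → halfSum (λ w → + W v w) (λ w → s v w * x v w) _ (λ w → SignedHalves.twice₁ (H v w)) (rows v) (s-row v)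
      ; row₂ = λ v → halfSum (λ w → + W v w) (λ w → - (s v w * x v w)) _ (λ w → SignedHalves.twice₂ (H v w)) (rows v) (neg0 _ (s-row v))
      ; col₁ = λ w → halfSum (λ v → + W v w) (λ v → s v w * x v w) _ (λ v → SignedHalves.twice₁ (H v w)) (cols w) (s-col w)
      ; col₂ = λ w → halfSum (λ v → + W v w) (λ v → - (s v w * x v w)) _ (λ v → SignedHalves.twice₂ (H v w)) (cols w) (neg0 _ (s-col w)) }

-- Perfect matchings in regular bipartite graphs

module _ {n : ℕ} (R : Fin n → Fin n → Bool) (R-irrefl : ∀ v → R v v ≡ false) (U : Fin n → Bool) where

  -- `R` is read as a bipartite graph between rows and columns. Rows and columns marked by `U` have
  -- degree `t`; all others are isolated.
  RegularOn : ℕ → Set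
  RegularOn t = (∀ v → sum {n} (λ w → ⟦ R v w ⟧) ≡ + t * ⟦ U v ⟧)
              × (∀ w → sum {n} (λ v → ⟦ R v w ⟧) ≡ + t * ⟦ U w ⟧)

  record PerfectMatching : Set where
    field
      M     : Fin n → Fin n → Bool
      M⊆R   : ∀ v w → M v w ≡ true → R v w ≡ true
      M-row : ∀ v → sum {n} (λ w → ⟦ M v w ⟧) ≡ ⟦ U v ⟧
      M-col : ∀ w → sum {n} (λ v → ⟦ M v w ⟧) ≡ ⟦ U w ⟧

  private
    -- Alon's proof of König's theorem: a few diagonal entries pad a multiple of R to degree 2 ^ s,
    -- and halving s times, always keeping the half with fewer diagonal entries, leaves a matching in R.
    record Padded (j : ℕ) (W : Fin n → Fin n → ℕ) : Set where
      field
        rows : ∀ v → row W v ≡ + (2 ℕ.^ j) * ⟦ U v ⟧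
        cols : ∀ v → col W v ≡ + (2 ℕ.^ j) * ⟦ U v ⟧
        few  : trace W ℤ.< + (2 ℕ.^ j)
        supp : ∀ v w → v ≢ w → R v w ≡ false → W v w ≡ 0

    sum≡0⇒ˡ : ∀ {a b} → + a + + b ≡ 0ℤ → a ≡ 0
    sum≡0⇒ˡ {zero}  _  = refl
    sum≡0⇒ˡ {suc a} ()

    step : ∀ {j W} → Padded (suc j) W → ∃ (Padded j)
    step {j} {W} p = choose (trace W₁ ℤₚ.<? c)
      where
      open Padded p
      c = + (2 ℕ.^ j)
      dbl : ∀ x → + (2 ℕ.^ suc j) * x ≡ c * x + c * x
      dbl x = trans (cong (_* x) (trans (ℤₚ.pos-* 2 (2 ℕ.^ j)) refl)) (lem c x)
        where
        lem : ∀ c x → + 2 * c * x ≡ c * x + c * x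
        lem = solve-∀
      H : Halving W (λ v → c * ⟦ U v ⟧) (λ v → c * ⟦ U v ⟧)
      H = halve W (λ v → c * ⟦ U v ⟧) (λ v → c * ⟦ U v ⟧) (λ v → trans (rows v) (dbl ⟦ U v ⟧)) (λ v → trans (cols v) (dbl ⟦ U v ⟧))
      open Halving H
      tr : trace W₁ + trace W₂ ≡ trace W
      tr = trans (sym (∑-distrib-+ {n} (λ v → + W₁ v v) (λ v → + W₂ v v))) (sum-cong-≗ {n} (λ v → total v v))
      zero-total : ∀ v w → v ≢ w → R v w ≡ false → + W₁ v w + + W₂ v w ≡ 0ℤ
      zero-total v w v≢w eq = trans (total v w) (cong +_ (supp v w v≢w eq))
      choose : Dec (trace W₁ ℤ.< c) → ∃ (Padded j)
      choose (yes lt) = W₁ , record { rows = row₁ ; cols = col₁ ; few = lt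
        ; supp = λ v w v≢w eq → sum≡0⇒ˡ (zero-total v w v≢w eq) }
      -- If the trace of `W₂` were at least `c` too, the trace of `W` would reach twice `c`,
      -- contrary to `few`.
      choose (no ≮) = W₂ , record { rows = row₂ ; cols = col₂ ; few = ℤₚ.≰⇒> λ c≤ →
          ℤₚ.<-irrefl refl (ℤₚ.<-≤-trans few (subst₂ ℤ._≤_ c+c tr (ℤₚ.+-mono-≤ (ℤₚ.≮⇒≥ ≮) c≤)))
        ; supp = λ v w v≢w eq → sum≡0⇒ˡ {W₂ v w} {W₁ v w} (trans (ℤₚ.+-comm (+ W₂ v w) (+ W₁ v w)) (zero-total v w v≢w eq)) }
        where
        c+c : c + c ≡ + (2 ℕ.^ suc j)
        c+c = trans (sym (cong₂ _+_ (ℤₚ.*-identityʳ c) (ℤₚ.*-identityʳ c))) (trans (sym (dbl 1ℤ)) (ℤₚ.*-identityʳ _))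

    descend : ∀ j {W} → Padded j W → ∃ (Padded 0)
    descend zero    p = _ , p
    descend (suc j) p = descend j (proj₂ (step p))

    -- Line sums at most 1 force entries 0 or 1, and a trace below 1 means that no padding has
    -- survived, so every nonzero entry lies in `R`.
    extract : ∀ {W} → Padded 0 W → PerfectMatching
    extract {W} p = record
      { M = M ; M⊆R = M⊆R
      ; M-row = λ v → trans (sum-cong-≗ {n} (λ w → sym (W≡M v w))) (trans (rows v) (ℤₚ.*-identityˡ _))
      ; M-col = λ v → trans (sum-cong-≗ {n} (λ w → sym (W≡M w v))) (trans (cols v) (ℤₚ.*-identityˡ _)) }
      where
      open Padded p
      positive : ℕ → Bool
      positive zero    = false
      positive (suc _) = true
      M : Fin n → Fin n → Bool
      M v w = positive (W v w)
      ⟦⟧≤1 : ∀ b → 1ℤ * ⟦ b ⟧ ℤ.≤ 1ℤ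
      ⟦⟧≤1 true  = ℤₚ.≤-refl
      ⟦⟧≤1 false = ℤ.+≤+ ℕ.z≤n
      W≤1 : ∀ v w → + W v w ℤ.≤ 1ℤ
      W≤1 v w = ℤₚ.≤-trans (term≤sum {n} (λ w → +-nonneg (W v w)) w) (subst (ℤ._≤ 1ℤ) (sym (rows v)) (⟦⟧≤1 (U v)))
      bit : ∀ k → + k ℤ.≤ 1ℤ → + k ≡ ⟦ positive k ⟧
      bit zero          _ = refl
      bit (suc zero)    _ = refl
      bit (suc (suc k)) (ℤ.+≤+ (ℕ.s≤s ()))
      W≡M : ∀ v w → + W v w ≡ ⟦ M v w ⟧
      W≡M v w = bit (W v w) (W≤1 v w)
      diag : ∀ k → + k ℤ.< 1ℤ → k ≡ 0
      diag zero    _ = refl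
      diag (suc k) (ℤ.+<+ (ℕ.s≤s ()))
      vanish : ∀ k → k ≡ 0 → positive k ≢ true
      vanish zero refl ()
      M⊆R : ∀ v w → M v w ≡ true → R v w ≡ true
      M⊆R v w m with v Finₚ.≟ w | R v w in eq
      ... | _        | true  = refl
      ... | no v≢w   | false = ⊥-elim (vanish _ (supp v w v≢w eq) m)
      ... | yes refl | false = ⊥-elim (vanish _ (diag _ (ℤₚ.≤-<-trans (term≤sum {n} (λ v → +-nonneg (W v v)) v) few)) m)

    n<2^n : ∀ k → k ℕ.< 2 ℕ.^ k
    n<2^n zero    = ℕ.s≤s ℕ.z≤n
    n<2^n (suc k) = ℕₚ.≤-trans (ℕₚ.+-mono-≤ (ℕₚ.m^n>0 2 k) (n<2^n k))
      (ℕₚ.≤-reflexive (cong (2 ℕ.^ k ℕ.+_) (sym (ℕₚ.+-identityʳ _))))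

    -- `a` copies of `R` and `b` diagonal entries in each marked row give line sum `2 ^ s`. As `R`
    -- is irreflexive, the diagonal holds only padding, whose total is at most `n` times `b`.
    module Pad (t s a b : ℕ) (size : + a * + t + + b ≡ + (2 ℕ.^ s)) (b-small : n ℕ.* b ℕ.< 2 ℕ.^ s)
      (R-row : ∀ v → sum {n} (λ w → ⟦ R v w ⟧) ≡ + t * ⟦ U v ⟧)
      (R-col : ∀ w → sum {n} (λ v → ⟦ R v w ⟧) ≡ + t * ⟦ U w ⟧) where
      dg : Fin n → Fin n → Bool
      dg v w = does (v Finₚ.≟ w) ∧ U v
      W : Fin n → Fin n → ℕ
      W v w = a ℕ.* ∥ R v w ∥ ℕ.+ b ℕ.* ∥ dg v w ∥
      W-ℤ : ∀ v w → + W v w ≡ + a * ⟦ R v w ⟧ + + b * ⟦ dg v w ⟧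
      W-ℤ v w = trans (ℤₚ.pos-+ (a ℕ.* ∥ R v w ∥) _) (cong₂ _+_
        (trans (ℤₚ.pos-* a _) (cong (+ a *_) (sym (⟦⟧≡+∥∥ (R v w)))))
        (trans (ℤₚ.pos-* b _) (cong (+ b *_) (sym (⟦⟧≡+∥∥ (dg v w))))))
      dg-off : ∀ v w → v ≢ w → dg v w ≡ false
      dg-off v w v≢w rewrite dec-false (v Finₚ.≟ w) v≢w = refl
      dg-on : ∀ v → dg v v ≡ U v
      dg-on v rewrite dec-true (v Finₚ.≟ v) refl = refl
      line : (f g : Fin n → Bool) (v : Fin n) → sum {n} (λ w → ⟦ f w ⟧) ≡ + t * ⟦ U v ⟧ →
        (∀ w → w ≢ v → g w ≡ false) → g v ≡ U v →
        sum {n} (λ w → + a * ⟦ f w ⟧ + + b * ⟦ g w ⟧) ≡ + (2 ℕ.^ s) * ⟦ U v ⟧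
      line f g v sf g-off g-on = trans (∑-distrib-+ {n} _ (λ w → + b * ⟦ g w ⟧)) (trans (cong₂ _+_
        (trans (sym (*-distribˡ-sum {n} (+ a) _)) (cong (+ a *_) sf))
        (trans (sym (*-distribˡ-sum {n} (+ b) _)) (cong (+ b *_)
          (trans (sum-single v _ (λ w w≢v → cong ⟦_⟧ (g-off w w≢v))) (cong ⟦_⟧ g-on)))))
        (trans (lem (+ a) (+ b) (+ t) ⟦ U v ⟧) (cong (_* ⟦ U v ⟧) size)))
        where
        lem : ∀ a b t u → a * (t * u) + b * u ≡ (a * t + b) * u
        lem = solve-∀
      diag≤b : ∀ v → + W v v ℤ.≤ + b
      diag≤b v rewrite R-irrefl v | dg-on v | ℕₚ.*-zeroʳ a with U v
      ... | true  = ℤ.+≤+ (ℕₚ.≤-reflexive (ℕₚ.*-identityʳ b))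
      ... | false = ℤ.+≤+ (ℕₚ.≤-trans (ℕₚ.≤-reflexive (ℕₚ.*-zeroʳ b)) ℕ.z≤n)
      padded : Padded s W
      padded = record
        { rows = λ v → trans (sum-cong-≗ {n} (W-ℤ v))
            (line (R v) (dg v) v (R-row v) (λ w w≢v → dg-off v w (w≢v ∘ sym)) (dg-on v))
        ; cols = λ v → trans (sum-cong-≗ {n} (λ w → W-ℤ w v))
            (line (λ w → R w v) (λ w → dg w v) v (R-col v) (λ w → dg-off w v) (dg-on v))
        ; few = ℤₚ.≤-<-trans (sum-mono-≤ {n} diag≤b) (subst (ℤ._< + (2 ℕ.^ s)) (sym (sum-const n b)) (ℤ.+<+ b-small))
        ; supp = λ v w v≢w eq → supp v w v≢w eq }
        where
        supp : ∀ v w → v ≢ w → R v w ≡ false → W v w ≡ 0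
        supp v w v≢w eq rewrite eq | dg-off v w v≢w = cong₂ ℕ._+_ (ℕₚ.*-zeroʳ a) (ℕₚ.*-zeroʳ b)

  abstract
    perfectMatching : ∀ t → RegularOn (suc t) → PerfectMatching
    perfectMatching t′ (R-row , R-col) = extract (proj₂ (descend s (Pad.padded t s a b size b-small R-row R-col)))
      where
      t s a b : ℕ
      t = suc t′
      -- This exponent makes `2 ^ s` exceed `n` times `t`, hence also `n` times the remainder `b`.
      s = n ℕ.* t
      a = 2 ℕ.^ s ℕ./ t
      b = 2 ℕ.^ s ℕ.% t
      size : + a * + t + + b ≡ + (2 ℕ.^ s)
      size = trans (ℤₚ.+-comm (+ a * + t) (+ b)) (trans (cong (λ z → + b + z) (sym (ℤₚ.pos-* a t)))
        (trans (sym (ℤₚ.pos-+ b (a ℕ.* t))) (cong +_ (sym (ℕ.m≡m%n+[m/n]*n (2 ℕ.^ s) t)))))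
      b-small : n ℕ.* b ℕ.< 2 ℕ.^ s
      b-small = ℕₚ.≤-<-trans (ℕₚ.*-monoʳ-≤ n (ℕₚ.<⇒≤ (ℕ.m%n<n (2 ℕ.^ s) t))) (n<2^n s)

  -- Edge weightings with prescribed line sums

  record Weighting (P : ℤ → Set) (c : ℤ) : Set where
    field
      F     : Fin n → Fin n → ℤ
      off   : ∀ v w → R v w ≡ false → F v w ≡ 0ℤ
      on    : ∀ v w → R v w ≡ true → P (F v w)
      F-row : ∀ v → sum {n} (F v) ≡ c * ⟦ U v ⟧
      F-col : ∀ w → sum {n} (λ v → F v w) ≡ c * ⟦ U w ⟧

-- Peel off one perfect matching for each prescribed weight.
weighting : ∀ {n} {P : ℤ → Set} (U : Fin n → Bool) (cs : List ℤ) → All P cs →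
  (R : Fin n → Fin n → Bool) (R-irrefl : ∀ v → R v v ≡ false) →
  RegularOn R R-irrefl U (length cs) → Weighting R R-irrefl U P (sumℤ cs)
weighting {n} U [] [] R R-irrefl (R-row , _) = record
  { F = λ _ _ → 0ℤ ; off = λ _ _ _ → refl ; on = λ v w eq → ⊥-elim (absurd v w eq)
  ; F-row = λ v → sum-0 {n} (λ _ → refl) ; F-col = λ v → sum-0 {n} (λ _ → refl) }
  where
  1≰0 : ¬ 1ℤ ℤ.≤ 0ℤ
  1≰0 (ℤ.+≤+ ())
  absurd : ∀ v w → R v w ≢ true
  absurd v w eq = 1≰0 (subst₂ ℤ._≤_ (cong ⟦_⟧ eq) (R-row v) (term≤sum {n} (λ w → ⟦⟧-nonneg (R v w)) w))
weighting {n} {P} U (c ∷ cs) (pc ∷ pcs) R R-irrefl reg@(R-row , R-col) = record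
  { F = λ v w → F v w + c * ⟦ M v w ⟧
  ; off = λ v w → proj₁ (entry (R v w) (M v w) (F v w) (M⊆R v w) (off v w) (on v w))
  ; on = λ v w → proj₂ (entry (R v w) (M v w) (F v w) (M⊆R v w) (off v w) (on v w))
  ; F-row = λ v → line (F v) (M v) v (F-row v) (M-row v)
  ; F-col = λ w → line (λ v → F v w) (λ v → M v w) w (F-col w) (M-col w) }
  where
  open PerfectMatching (perfectMatching R R-irrefl U (length cs) reg)
  R′ : Fin n → Fin n → Bool
  R′ v w = R v w ∧ not (M v w)
  R′-irrefl : ∀ v → R′ v v ≡ false
  R′-irrefl v rewrite R-irrefl v = refl
  diff : ∀ v w → ⟦ R′ v w ⟧ ≡ ⟦ R v w ⟧ - ⟦ M v w ⟧
  diff v w with R v w in r | M v w in m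
  ... | true  | true  = refl
  ... | true  | false = refl
  ... | false | false = refl
  ... | false | true with trans (sym (M⊆R v w m)) r
  ...   | ()
  less : (f f′ g : Fin n → Bool) (v : Fin n) → (∀ w → ⟦ f′ w ⟧ ≡ ⟦ f w ⟧ - ⟦ g w ⟧) →
    sum {n} (λ w → ⟦ f w ⟧) ≡ + suc (length cs) * ⟦ U v ⟧ → sum {n} (λ w → ⟦ g w ⟧) ≡ ⟦ U v ⟧ →
    sum {n} (λ w → ⟦ f′ w ⟧) ≡ + length cs * ⟦ U v ⟧
  less f f′ g v d sf sg = trans (sum-cong-≗ {n} d) (trans (sum-minus {n} _ _)
    (trans (cong₂ _-_ sf sg) (lem (+ length cs) ⟦ U v ⟧)))
    where
    lem : ∀ l u → (1ℤ + l) * u - u ≡ l * u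
    lem = solve-∀
  open Weighting (weighting U cs pcs R′ R′-irrefl
    ( (λ v → less (R v) (R′ v) (M v) v (diff v) (R-row v) (M-row v))
    , (λ w → less (λ v → R v w) (λ v → R′ v w) (λ v → M v w) w (λ v → diff v w) (R-col w) (M-col w))))
  entry : ∀ r m f → (m ≡ true → r ≡ true) → (r ∧ not m ≡ false → f ≡ 0ℤ) → (r ∧ not m ≡ true → P f) →
    (r ≡ false → f + c * ⟦ m ⟧ ≡ 0ℤ) × (r ≡ true → P (f + c * ⟦ m ⟧))
  entry true  true  f _   f-off _    = (λ ()) ,
    λ _ → subst P (sym (trans (cong₂ _+_ (f-off refl) (ℤₚ.*-identityʳ c)) (ℤₚ.+-identityˡ c))) pc
  entry true  false f _   _     f-on = (λ ()) ,
    λ _ → subst P (sym (trans (cong (λ z → f + z) (ℤₚ.*-zeroʳ c)) (ℤₚ.+-identityʳ f))) (f-on refl)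
  entry false false f _   f-off _    = (λ _ → cong₂ _+_ (f-off refl) (ℤₚ.*-zeroʳ c)) , λ ()
  entry false true  f m⊆r _     _    with m⊆r refl
  ... | ()
  line : (f : Fin n → ℤ) (g : Fin n → Bool) (v : Fin n) → sum {n} f ≡ sumℤ cs * ⟦ U v ⟧ →
    sum {n} (λ w → ⟦ g w ⟧) ≡ ⟦ U v ⟧ → sum {n} (λ w → f w + c * ⟦ g w ⟧) ≡ (c + sumℤ cs) * ⟦ U v ⟧
  line f g v sf sg = trans (∑-distrib-+ {n} f _) (trans (cong₂ _+_ sf
    (trans (sym (*-distribˡ-sum {n} c _)) (cong (c *_) sg))) (lem (sumℤ cs) c ⟦ U v ⟧))
    where
    lem : ∀ s c u → s * u + c * u ≡ (c + s) * u
    lem = solve-∀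

-- Pairs 1, -1 settle even lengths; an odd length takes one triple 1, 1, -2 in addition, which needs
-- length at least 3.
zeroSumWeights : ∀ t → Σ (List ℤ) λ cs → length cs ≡ 2 ℕ.+ t × sumℤ cs ≡ 0ℤ × All Small cs
zeroSumWeights zero = 1ℤ ∷ -1ℤ ∷ [] , refl , refl , sign⇒small (inj₁ refl) ∷ sign⇒small (inj₂ refl) ∷ []
zeroSumWeights (suc zero) = 1ℤ ∷ 1ℤ ∷ ℤ.-[1+ 1 ] ∷ [] , refl , refl ,
  sign⇒small (inj₁ refl) ∷ sign⇒small (inj₁ refl) ∷ ((λ ()) , ℕ.s≤s (ℕ.s≤s (ℕ.s≤s ℕ.z≤n))) ∷ []
zeroSumWeights (suc (suc t)) = let cs , len , s , small = zeroSumWeights t in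
  1ℤ ∷ -1ℤ ∷ cs , cong (2 ℕ.+_) len , cong (λ z → 1ℤ + (-1ℤ + z)) s ,
  sign⇒small (inj₁ refl) ∷ sign⇒small (inj₂ refl) ∷ small

-- Flows on edges between different classes

module _ {n : ℕ} where
  open Eulerian (Finₚ._≟_ {n}) using (δ; δ-refl; δ-≢)

  -- Sorting the summands by the class of `w` fixes the class in each inner sum, where the weighting
  -- for one single pair of classes then applies.
  sum-fibres : (rep : Fin n → Fin n) (h : Fin n → Fin n → ℤ) →
    sum (λ w → h (rep w) w) ≡ sum {n} (λ q → sum {n} (λ w → δ (rep w) q * h q w))
  sum-fibres rep h = trans (sum-cong-≗ {n} pointwise) (∑-comm {n} {n} _)
    where
    pointwise : ∀ w → h (rep w) w ≡ sum {n} (λ q → δ (rep w) q * h q w)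
    pointwise w = sym (trans (sum-single (rep w) (λ q → δ (rep w) q * h q w)
        (λ q q≢ → trans (cong (_* h q w) (δ-≢ (q≢ ∘ sym))) (ℤₚ.*-zeroˡ (h q w))))
      (trans (cong (_* h (rep w) w) (δ-refl (rep w))) (ℤₚ.*-identityˡ _)))

module _ {n : ℕ} (X : Fin n → Fin n → Bool) (X-sym : ∀ u v → X u v ≡ X v u)
  (rep : Fin n → Fin n) (t : ℕ)
  (no-inner : ∀ v w → X v w ≡ true → rep v ≢ rep w)
  (multi : ∀ v w → X v w ≡ true → sum {n} (λ w′ → ⟦ X v w′ ∧ does (rep w′ Finₚ.≟ rep w) ⟧) ≡ + (2 ℕ.+ t)) where

  open Eulerian (Finₚ._≟_ {n}) using (δ; δ-refl; δ-≢)

  private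
    inside : Fin n → Fin n → Fin n → Fin n → Bool
    inside p q v w = does (rep v Finₚ.≟ p) ∧ does (rep w Finₚ.≟ q)

    -- The edges between the classes `p` and `q` in both directions. Being symmetric, the relation
    -- has the same nonempty rows and columns, and one set `U p q` marks both.
    R : Fin n → Fin n → Fin n → Fin n → Bool
    R p q v w = X v w ∧ (inside p q v w ∨ inside q p v w)

    U : Fin n → Fin n → Fin n → Bool
    U p q v = does (Finₚ.any? (λ w → R p q v w Boolₚ.≟ true))

    R-cases : ∀ p q v w → R p q v w ≡ true →
      X v w ≡ true × ((rep v ≡ p × rep w ≡ q) ⊎ (rep v ≡ q × rep w ≡ p))
    R-cases p q v w eq with X v w | rep v Finₚ.≟ p | rep w Finₚ.≟ q | rep v Finₚ.≟ q | rep w Finₚ.≟ p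
    ... | true | yes a | yes b | _     | _     = refl , inj₁ (a , b)
    ... | true | yes _ | no _  | yes c | yes d = refl , inj₂ (c , d)
    ... | true | no _  | _     | yes c | yes d = refl , inj₂ (c , d)
    R-cases p q v w () | true  | yes _ | no _  | yes _ | no _
    R-cases p q v w () | true  | yes _ | no _  | no _  | _
    R-cases p q v w () | true  | no _  | _     | yes _ | no _
    R-cases p q v w () | true  | no _  | _     | no _  | _
    R-cases p q v w () | false | _     | _     | _     | _

    R-sym : ∀ p q v w → R p q v w ≡ R p q w v
    R-sym p q v w = cong₂ _∧_ (X-sym v w)
      (trans (cong₂ _∨_ (Boolₚ.∧-comm (does (rep v Finₚ.≟ p)) _) (Boolₚ.∧-comm (does (rep v Finₚ.≟ q)) _))
             (Boolₚ.∨-comm (inside q p w v) _))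

    R-irrefl : ∀ p q v → R p q v v ≡ false
    R-irrefl p q v = Boolₚ.¬-not λ eq → no-inner v v (proj₁ (R-cases p q v v eq)) refl

    R-inner : ∀ p q v w → rep v ≡ p → p ≢ q → R p q v w ≡ X v w ∧ does (rep w Finₚ.≟ q)
    R-inner p q v w v∈p p≢q = cong (X v w ∧_) (trans
      (cong₂ _∨_ (cong (_∧ does (rep w Finₚ.≟ q)) (dec-true (rep v Finₚ.≟ p) v∈p))
                 (cong (_∧ does (rep w Finₚ.≟ p)) (dec-false (rep v Finₚ.≟ q) (λ e → p≢q (trans (sym v∈p) e)))))
      (Boolₚ.∨-identityʳ _))

    R-swap : ∀ p q v w → R p q v w ≡ R q p v w
    R-swap p q v w = cong (X v w ∧_) (Boolₚ.∨-comm (inside p q v w) _)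

    count : ∀ p q v w → X v w ≡ true → rep v ≡ p → rep w ≡ q →
      sum {n} (λ w′ → ⟦ R p q v w′ ⟧) ≡ + (2 ℕ.+ t)
    count p q v w x refl refl =
      trans (sum-cong-≗ {n} (λ w′ → cong ⟦_⟧ (R-inner p q v w′ refl (no-inner v w x)))) (multi v w x)

    R-row : ∀ p q v → sum {n} (λ w → ⟦ R p q v w ⟧) ≡ + (2 ℕ.+ t) * ⟦ U p q v ⟧
    R-row p q v with Finₚ.any? (λ w → R p q v w Boolₚ.≟ true)
    ... | no none = trans (sum-0 {n} (λ w → cong ⟦_⟧ (Boolₚ.¬-not (λ eq → none (w , eq))))) (sym (ℤₚ.*-zeroʳ (+ (2 ℕ.+ t))))
    ... | yes (w , eq) with R-cases p q v w eq
    ...   | x , inj₁ (a , b) = trans (count p q v w x a b) (sym (ℤₚ.*-identityʳ _))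
    ...   | x , inj₂ (a , b) = trans (sum-cong-≗ {n} (λ w′ → cong ⟦_⟧ (R-swap p q v w′)))
                                 (trans (count q p v w x a b) (sym (ℤₚ.*-identityʳ _)))

    R-col : ∀ p q v → sum {n} (λ w → ⟦ R p q w v ⟧) ≡ + (2 ℕ.+ t) * ⟦ U p q v ⟧
    R-col p q v = trans (sum-cong-≗ {n} (λ w → cong ⟦_⟧ (R-sym p q w v))) (R-row p q v)

    abstract
      G : ∀ p q → Weighting (R p q) (R-irrefl p q) (U p q) Small 0ℤ
      G p q = let cs , len , s , sm = zeroSumWeights t in
        subst (Weighting (R p q) (R-irrefl p q) (U p q) Small) s
          (weighting (U p q) cs sm (R p q) (R-irrefl p q)
            (subst (RegularOn (R p q) (R-irrefl p q) (U p q)) (sym len) (R-row p q , R-col p q)))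

    g : Fin n → Fin n → Fin n → Fin n → ℤ
    g p q = Weighting.F (G p q)

    up : Fin n → Fin n → ℤ
    up p q = ⟦ does (p Finₚ.<? q) ⟧

    up-< : ∀ {p q} → p Fin.< q → up p q ≡ 1ℤ
    up-< {p} {q} lt = cong ⟦_⟧ (dec-true (p Finₚ.<? q) lt)

    up-≮ : ∀ {p q} → ¬ p Fin.< q → up p q ≡ 0ℤ
    up-≮ {p} {q} ge = cong ⟦_⟧ (dec-false (p Finₚ.<? q) ge)

    -- Only arcs from the smaller class to the larger one receive a weight in `A`; so on each edge
    -- at most one of the two terms of `F` is nonzero.
    A F : Fin n → Fin n → ℤ
    A v w = up (rep v) (rep w) * g (rep v) (rep w) v w
    F v w = A v w - A w v

    g-out : ∀ p q v w → p Fin.< q → rep v ≡ p → rep w ≢ q → g p q v w ≡ 0ℤ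
    g-out p q v w p<q v∈p w∉q = Weighting.off (G p q) v w (trans (R-inner p q v w v∈p (Finₚ.<⇒≢ p<q))
      (trans (cong (X v w ∧_) (dec-false (rep w Finₚ.≟ q) w∉q)) (Boolₚ.∧-zeroʳ (X v w))))

    g-out′ : ∀ p q w v → p Fin.< q → rep v ≡ q → rep w ≢ p → g p q w v ≡ 0ℤ
    g-out′ p q w v p<q v∈q w∉p = Weighting.off (G p q) w v (trans (R-sym p q w v) (trans (R-swap p q v w)
      (trans (R-inner q p v w v∈q (λ e → Finₚ.<⇒≢ p<q (sym e)))
      (trans (cong (X v w ∧_) (dec-false (rep w Finₚ.≟ p) w∉p)) (Boolₚ.∧-zeroʳ (X v w))))))

    δ-absorb : ∀ (u : ℤ) (z : ℤ) w q → (rep w ≢ q → u * z ≡ 0ℤ) → δ (rep w) q * (u * z) ≡ u * z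
    δ-absorb u z w q h with rep w Finₚ.≟ q
    ... | yes _  = ℤₚ.*-identityˡ _
    ... | no ne = trans (ℤₚ.*-zeroˡ (u * z)) (sym (h ne))

    up-* : ∀ p q z → (p Fin.< q → z ≡ 0ℤ) → up p q * z ≡ 0ℤ
    up-* p q z h with p Finₚ.<? q
    ... | yes lt = trans (cong (_* z) (up-< lt)) (trans (ℤₚ.*-identityˡ z) (h lt))
    ... | no ge  = trans (cong (_* z) (up-≮ ge)) (ℤₚ.*-zeroˡ z)

    -- For each larger class `q`, the row of `g p q` at `v` is supported in `q` by `g-out`, so the
    -- sum over that class is a full row sum of a zero-sum weighting.
    A-row : ∀ v → sum (A v) ≡ 0ℤ
    A-row v = trans (sum-fibres rep (λ q w → up p q * g p q v w)) (sum-0 {n} λ q →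
        trans (sum-cong-≗ {n} λ w → δ-absorb (up p q) (g p q v w) w q
                (λ ne → up-* p q _ (λ lt → g-out p q v w lt refl ne)))
        (trans (sym (*-distribˡ-sum {n} (up p q) _)) (trans (cong (up p q *_) (Weighting.F-row (G p q) v))
          (ℤₚ.*-zeroʳ (up p q)))))
      where
      p = rep v

    A-col : ∀ v → sum (λ w → A w v) ≡ 0ℤ
    A-col v = trans (sum-fibres rep (λ p w → up p q * g p q w v)) (sum-0 {n} λ p →
        trans (sum-cong-≗ {n} λ w → δ-absorb (up p q) (g p q w v) w p
                (λ ne → up-* p q _ (λ lt → g-out′ p q w v lt refl ne)))
        (trans (sym (*-distribˡ-sum {n} (up p q) _)) (trans (cong (up p q *_) (Weighting.F-col (G p q) v))
          (ℤₚ.*-zeroʳ (up p q)))))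
      where
      q = rep v

    R-on : ∀ v w → X v w ≡ true → R (rep v) (rep w) v w ≡ true
    R-on v w x rewrite x | dec-true (rep v Finₚ.≟ rep v) refl | dec-true (rep w Finₚ.≟ rep w) refl = refl

    R-off : ∀ p q v w → X v w ≡ false → R p q v w ≡ false
    R-off p q v w x rewrite x = refl

    A-off : ∀ v w → X v w ≡ false → A v w ≡ 0ℤ
    A-off v w x = trans (cong (up (rep v) (rep w) *_) (Weighting.off (G (rep v) (rep w)) v w (R-off _ _ v w x)))
      (ℤₚ.*-zeroʳ (up (rep v) (rep w)))

    small : ∀ v w → X v w ≡ true → Small (F v w)
    small v w x = pick (Finₚ.<-cmp (rep v) (rep w))
      where
      onlyˡ : ∀ x y → 1ℤ * x - 0ℤ * y ≡ x
      onlyˡ = solve-∀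
      onlyʳ : ∀ x y → 0ℤ * x - 1ℤ * y ≡ - y
      onlyʳ = solve-∀
      neg-small : ∀ {z} → Small z → Small (- z)
      neg-small {z} (nz , lt) = (λ eq → nz (ℤₚ.neg-injective eq)) , subst (ℕ._< 3) (sym (ℤₚ.∣-i∣≡∣i∣ z)) lt
      pick : _ → Small (F v w)
      pick (tri< lt _ gt) = subst Small
        (sym (trans (cong₂ (λ a b → a * g (rep v) (rep w) v w - b * g (rep w) (rep v) w v) (up-< lt) (up-≮ gt)) (onlyˡ (g (rep v) (rep w) v w) (g (rep w) (rep v) w v))))
        (Weighting.on (G (rep v) (rep w)) v w (R-on v w x))
      pick (tri≈ _ eq _) = ⊥-elim (no-inner v w x eq)
      pick (tri> lt _ gt) = subst Small
        (sym (trans (cong₂ (λ a b → a * g (rep v) (rep w) v w - b * g (rep w) (rep v) w v) (up-≮ lt) (up-< gt)) (onlyʳ (g (rep v) (rep w) v w) (g (rep w) (rep v) w v))))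
        (neg-small (Weighting.on (G (rep w) (rep v)) w v (R-on w v (trans (X-sym w v) x))))

  abstract
    multicover : ∃ (Balanced X)
    multicover = F , record
      { off = λ v w x → cong₂ _-_ (A-off v w x) (A-off w v (trans (X-sym w v) x))
      ; small = small
      ; antisym = λ v w → swap (A w v) (A v w)
      ; balanced = λ v → trans (sum-minus {n} (A v) (λ w → A w v)) (cong₂ _-_ (A-row v) (A-col v)) }
      where
      swap : ∀ x y → x - y ≡ - (y - x)
      swap = solve-∀

-- Class representatives and two-colourings of classes

least : ∀ {n} {P : Fin n → Set} → (∀ i → Dec (P i)) → ∃ P → ∃ λ i → P i × (∀ j → P j → i Fin.≤ j)
least {suc n} {P} P? (i , p) with P? zero
... | yes p₀ = zero , p₀ , λ j _ → ℕ.z≤n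
... | no ¬p₀ = later i p
  where
  later : ∀ i → P i → ∃ λ i → P i × (∀ j → P j → i Fin.≤ j)
  later zero    p = ⊥-elim (¬p₀ p)
  later (suc i) p = let k , q , min = least (P? ∘ suc) (i , p) in
    suc k , q , λ { zero p₀ → ⊥-elim (¬p₀ p₀) ; (suc j) pj → ℕ.s≤s (min j pj) }

module Canonical {n} {_≈_ : Fin n → Fin n → Set} (≈-eq : IsDecEquivalence _≈_) where
  open IsDecEquivalence ≈-eq renaming (_≟_ to _≈?_; refl to ≈-refl; sym to ≈-sym; trans to ≈-trans)

  private
    found : ∀ v → ∃ λ w → v ≈ w × (∀ j → v ≈ j → w Fin.≤ j)
    found v = least (v ≈?_) (v , ≈-refl)

  abstract
    rep : Fin n → Fin n
    rep v = proj₁ (found v)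

    ≈-rep : ∀ v → v ≈ rep v
    ≈-rep v = proj₁ (proj₂ (found v))

    rep-cong : ∀ {v w} → v ≈ w → rep v ≡ rep w
    rep-cong {v} {w} v≈w = Finₚ.≤-antisym
      (proj₂ (proj₂ (found v)) _ (≈-trans v≈w (≈-rep w)))
      (proj₂ (proj₂ (found w)) _ (≈-trans (≈-sym v≈w) (≈-rep v)))

  rep-injective : ∀ {v w} → rep v ≡ rep w → v ≈ w
  rep-injective {v} {w} eq = ≈-trans (≈-rep v) (≈-trans (≈-reflexive eq) (≈-sym (≈-rep w)))
    where
    ≈-reflexive : ∀ {x y} → x ≡ y → x ≈ y
    ≈-reflexive refl = ≈-refl

  module _ (φ : Fin n → Fin n) (φ-resp : ∀ {v w} → v ≈ w → φ v ≈ φ w)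
           (φ-invol : ∀ v → φ (φ v) ≈ v) (φ-free : ∀ v → ¬ φ v ≈ v) where

    -- `φ` pairs off the classes without fixed points. The class with the smaller representative in
    -- a pair gets 1, its partner -1.
    side : Fin n → ℤ
    side v = if does (rep v Finₚ.<? rep (φ v)) then 1ℤ else -1ℤ

    side-sign : ∀ v → IsSign (side v)
    side-sign v with does (rep v Finₚ.<? rep (φ v))
    ... | true  = inj₁ refl
    ... | false = inj₂ refl

    side-flip : ∀ {v w} → w ≈ φ v → side w ≡ - side v
    side-flip {v} {w} w≈φv = go (Finₚ.<-cmp (rep v) (rep (φ v)))
      where
      w-side : side w ≡ (if does (rep (φ v) Finₚ.<? rep v) then 1ℤ else -1ℤ)
      w-side = cong₂ (λ p q → if does (p Finₚ.<? q) then 1ℤ else -1ℤ) (rep-cong w≈φv)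
        (rep-cong (≈-trans (φ-resp w≈φv) (φ-invol v)))
      pick : ∀ {p q} → p Fin.< q → (if does (p Finₚ.<? q) then 1ℤ else -1ℤ) ≡ 1ℤ
      pick {p} {q} lt = cong (λ b → if b then 1ℤ else -1ℤ) (dec-true (p Finₚ.<? q) lt)
      pick′ : ∀ {p q} → ¬ p Fin.< q → (if does (p Finₚ.<? q) then 1ℤ else -1ℤ) ≡ -1ℤ
      pick′ {p} {q} ge = cong (λ b → if b then 1ℤ else -1ℤ) (dec-false (p Finₚ.<? q) ge)
      go : _ → side w ≡ - side v
      go (tri< lt _ gt) = trans w-side (trans (pick′ gt) (cong -_ (sym (pick lt))))
      go (tri≈ _ eq _)  = ⊥-elim (φ-free v (≈-sym (rep-injective eq)))
      go (tri> lt _ gt) = trans w-side (trans (pick gt) (cong -_ (sym (pick′ lt))))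

-- Cubes generated by three commuting involutions

module Extend {n} {_≈_ : Fin n → Fin n → Set} (≈-eq : IsDecEquivalence _≈_)
  (x : Fin n → Fin n) (x-resp : ∀ {v w} → v ≈ w → x v ≈ x w) (x-invol : ∀ v → x (x v) ≈ v) where
  open IsDecEquivalence ≈-eq renaming (_≟_ to _≈?_; refl to ≈-refl; sym to ≈-sym; trans to ≈-trans)

  -- Each class is merged with its image under `x`, so the new classes are the orbits of the
  -- involution that `x` induces on the old ones.
  _≈⁺_ : Fin n → Fin n → Set
  v ≈⁺ w = v ≈ w ⊎ v ≈ x w

  ≈⁺-eq : IsDecEquivalence _≈⁺_
  ≈⁺-eq = record
    { isEquivalence = record { refl = inj₁ ≈-refl ; sym = ⁺-sym ; trans = ⁺-trans }
    ; _≟_ = λ v w → (v ≈? w) ⊎-dec (v ≈? x w) }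
    where
    ⁺-sym : ∀ {v w} → v ≈⁺ w → w ≈⁺ v
    ⁺-sym (inj₁ p) = inj₁ (≈-sym p)
    ⁺-sym (inj₂ p) = inj₂ (≈-sym (≈-trans (x-resp p) (x-invol _)))
    ⁺-trans : ∀ {u v w} → u ≈⁺ v → v ≈⁺ w → u ≈⁺ w
    ⁺-trans (inj₁ p) (inj₁ q) = inj₁ (≈-trans p q)
    ⁺-trans (inj₁ p) (inj₂ q) = inj₂ (≈-trans p q)
    ⁺-trans (inj₂ p) (inj₁ q) = inj₂ (≈-trans p (x-resp q))
    ⁺-trans (inj₂ p) (inj₂ q) = inj₁ (≈-trans p (≈-trans (x-resp q) (x-invol _)))

  resp⁺ : (f : Fin n → Fin n) → (∀ {v w} → v ≈ w → f v ≈ f w) → (∀ v → f (x v) ≈ x (f v)) →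
    ∀ {v w} → v ≈⁺ w → f v ≈⁺ f w
  resp⁺ f f-resp comm (inj₁ p) = inj₁ (f-resp p)
  resp⁺ f f-resp comm (inj₂ p) = inj₂ (≈-trans (f-resp p) (comm _))

module Cube {n} {_≈_ : Fin n → Fin n → Set} (≈-eq : IsDecEquivalence _≈_)
  (a b c : Fin n → Fin n)
  (a-resp : ∀ {v w} → v ≈ w → a v ≈ a w) (b-resp : ∀ {v w} → v ≈ w → b v ≈ b w)
  (c-resp : ∀ {v w} → v ≈ w → c v ≈ c w)
  (a-invol : ∀ v → a (a v) ≈ v) (b-invol : ∀ v → b (b v) ≈ v) (c-invol : ∀ v → c (c v) ≈ v)
  (ab : ∀ v → a (b v) ≈ b (a v)) (ac : ∀ v → a (c v) ≈ c (a v)) (bc : ∀ v → b (c v) ≈ c (b v))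
  (a-free : ∀ v → ¬ a v ≈ v) (b-free : ∀ v → ¬ b v ≈ v) (c-free : ∀ v → ¬ c v ≈ v)
  (indep : ∀ v → ¬ a (b v) ≈ c v) where
  open IsDecEquivalence ≈-eq renaming (_≟_ to _≈?_; refl to ≈-refl; sym to ≈-sym; trans to ≈-trans)

  private
    infixr 4 _◅_
    _◅_ : ∀ {u v w} → u ≈ v → v ≈ w → u ≈ w
    _◅_ = ≈-trans

    -- x and y generate the even words in a, b, c, and χ separates the two classes of even words in a cube.
    x y : Fin n → Fin n
    x v = a (b v)
    y v = a (c v)

    x-invol : ∀ v → x (x v) ≈ v
    x-invol v = a-resp (≈-sym (ab (b v))) ◅ a-invol _ ◅ b-invol v

    y-invol : ∀ v → y (y v) ≈ v
    y-invol v = a-resp (≈-sym (ac (c v))) ◅ a-invol _ ◅ c-invol v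

    module E₁ = Extend ≈-eq x (a-resp ∘ b-resp) x-invol

    yx : ∀ v → y (x v) ≈ x (y v)
    yx v = a-resp (≈-sym (ac (b v)) ◅ a-resp (≈-sym (bc v)) ◅ ab (c v))

    module E₂ = Extend E₁.≈⁺-eq y (E₁.resp⁺ y (a-resp ∘ c-resp) yx) (λ v → inj₁ (y-invol v))

    ax : ∀ v → a (x v) ≈ x (a v)
    ax v = a-resp (ab v)

    ay : ∀ v → a (y v) ≈ y (a v)
    ay v = a-resp (ac v)

    a-resp₂ : ∀ {v w} → v E₂.≈⁺ w → a v E₂.≈⁺ a w
    a-resp₂ = E₂.resp⁺ a (E₁.resp⁺ a a-resp ax) (λ v → inj₁ (ay v))

    cancel : ∀ {v w} → a v ≈ a w → v ≈ w
    cancel p = ≈-sym (a-invol _) ◅ a-resp p ◅ a-invol _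

    -- The odd words in three commuting involutions reduce to `a`, `b`, `c` and their product. That
    -- none of them fixes a class is the content of the three freeness hypotheses and `indep`; so
    -- the cubes are bipartite.
    a-free₂ : ∀ v → ¬ a v E₂.≈⁺ v
    a-free₂ v (inj₁ (inj₁ p)) = a-free v p
    a-free₂ v (inj₁ (inj₂ p)) = b-free v (≈-sym (cancel p))
    a-free₂ v (inj₂ (inj₁ p)) = c-free v (≈-sym (cancel p))
    a-free₂ v (inj₂ (inj₂ p)) = indep v (a-resp (b-resp (cancel p) ◅ b-invol _) ◅ a-invol _)

    a-invol₂ : ∀ v → a (a v) E₂.≈⁺ v
    a-invol₂ v = inj₁ (inj₁ (a-invol v))

    module C = Canonical E₂.≈⁺-eq

  abstract
    χ : Fin n → ℤ
    χ = C.side a a-resp₂ a-invol₂ a-free₂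

    χ-sign : ∀ v → IsSign (χ v)
    χ-sign = C.side-sign a a-resp₂ a-invol₂ a-free₂

    χ-a : ∀ {v w} → w ≈ a v → χ w ≡ - χ v
    χ-a p = C.side-flip a a-resp₂ a-invol₂ a-free₂ (inj₁ (inj₁ p))

    -- Modulo `≈` the vertex `b v` is `x (a v)`, hence an even word away from `a v`, and the change
    -- of sign under `a` carries over to `b`. The same holds for `c` with `y`.
    χ-b : ∀ {v w} → w ≈ b v → χ w ≡ - χ v
    χ-b {v} p = C.side-flip a a-resp₂ a-invol₂ a-free₂
      (inj₁ (inj₂ (p ◅ ≈-sym (a-invol _) ◅ a-resp (ab v))))

    χ-c : ∀ {v w} → w ≈ c v → χ w ≡ - χ v
    χ-c {v} p = C.side-flip a a-resp₂ a-invol₂ a-free₂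
      (inj₂ (inj₁ (p ◅ ≈-sym (a-invol _) ◅ a-resp (ac v))))

  module _ (X : Fin n → Fin n → Bool) (X-sym : ∀ u v → X u v ≡ X v u) (X-irrefl : ∀ v → X v v ≡ false)
    (unique : ∀ {v w w′} → X v w ≡ true → X v w′ ≡ true → w ≈ w′ → w ≡ w′)
    (a-nbr : ∀ v → ∃ λ w → X v w ≡ true × w ≈ a v) (b-nbr : ∀ v → ∃ λ w → X v w ≡ true × w ≈ b v)
    (c-nbr : ∀ v → ∃ λ w → X v w ≡ true × w ≈ c v)
    (a≉b : ∀ v → ¬ a v ≈ b v) (a≉c : ∀ v → ¬ a v ≈ c v) (b≉c : ∀ v → ¬ b v ≈ c v)
    (odd : ∀ v → Even (sum (λ w → ⟦ X v w ⟧) - + 3)) where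

    private
      module Colour (f : Fin n → Fin n) (f-resp : ∀ {v w} → v ≈ w → f v ≈ f w) (f-invol : ∀ v → f (f v) ≈ v)
        (f-nbr : ∀ v → ∃ λ w → X v w ≡ true × w ≈ f v) where

        E : Fin n → Fin n → Bool
        E v w = X v w ∧ does (w ≈? f v)

        E-true : ∀ {v w} → E v w ≡ true → X v w ≡ true × w ≈ f v
        E-true {v} {w} eq with X v w | w ≈? f v
        ... | true | yes p = refl , p
        E-true {v} {w} () | true  | no _
        E-true {v} {w} () | false | _

        E-intro : ∀ {v w} → X v w ≡ true → w ≈ f v → E v w ≡ true
        E-intro {v} {w} x p = cong₂ _∧_ x (dec-true (w ≈? f v) p)

        E-flip : ∀ {v w} → E v w ≡ true → E w v ≡ true
        E-flip {v} {w} eq = let x , p = E-true eq in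
          E-intro (trans (X-sym w v) x) (≈-sym (f-resp p ◅ f-invol v))

        E-sym : ∀ v w → E v w ≡ E w v
        E-sym v w with E v w in p | E w v in q
        ... | true  | true  = refl
        ... | false | false = refl
        ... | true  | false = trans (sym (E-flip p)) q
        ... | false | true  = trans (sym p) (E-flip q)

        -- `f-nbr` supplies a neighbour in the class of `f v` and `unique` excludes a second one:
        -- each colour is a perfect matching.
        E-row : ∀ v → sum {n} (λ w → ⟦ E v w ⟧) ≡ 1ℤ
        E-row v = let w , x , p = f-nbr v in
          trans (sum-single w (λ w → ⟦ E v w ⟧) (λ w′ w′≢w → cong ⟦_⟧ (Boolₚ.¬-not (λ eq →
              let x′ , p′ = E-true eq in w′≢w (unique x′ x (p′ ◅ ≈-sym p))))))
            (cong ⟦_⟧ (E-intro x p))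

      module A = Colour a a-resp a-invol a-nbr
      module B = Colour b b-resp b-invol b-nbr
      module D = Colour c c-resp c-invol c-nbr

      exclusive : ∀ {f g : Fin n → Fin n} {v w} → ¬ f v ≈ g v → w ≈ f v → ¬ w ≈ g v
      exclusive ne p q = ne (≈-sym p ◅ q)

      Y : Fin n → Fin n → Bool
      Y v w = X v w ∧ not (A.E v w ∨ B.E v w ∨ D.E v w)

      -- The three colours are mutually exclusive, so five of the sixteen Boolean combinations
      -- remain.
      data Kind : Bool → Bool → Bool → Bool → Set where
        none  : Kind false false false false
        kindA : Kind true true false false
        kindB : Kind true false true false
        kindC : Kind true false false true
        rest  : Kind true false false false

      kind : ∀ v w → Kind (X v w) (A.E v w) (B.E v w) (D.E v w)
      kind v w with X v w | w ≈? a v | w ≈? b v | w ≈? c v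
      ... | false | _     | _     | _     = none
      ... | true  | yes p | yes q | _     = ⊥-elim (exclusive {a} {b} (a≉b v) p q)
      ... | true  | yes p | no _  | yes r = ⊥-elim (exclusive {a} {c} (a≉c v) p r)
      ... | true  | yes p | no _  | no _  = kindA
      ... | true  | no _  | yes q | yes r = ⊥-elim (exclusive {b} {c} (b≉c v) q r)
      ... | true  | no _  | yes q | no _  = kindB
      ... | true  | no _  | no _  | yes r = kindC
      ... | true  | no _  | no _  | no _  = rest

      Y-val : ∀ {x p q r} → Kind x p q r → ⟦ x ∧ not (p ∨ q ∨ r) ⟧ ≡ ⟦ x ⟧ - (⟦ p ⟧ + ⟦ q ⟧ + ⟦ r ⟧)
      Y-val none  = refl
      Y-val kindA = refl
      Y-val kindB = refl
      Y-val kindC = refl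
      Y-val rest  = refl

      Y-even : ∀ v → Even (sum λ w → ⟦ Y v w ⟧)
      Y-even v = subst Even (sym (trans (sum-cong-≗ {n} (λ w → Y-val (kind v w)))
        (trans (sum-minus {n} _ _) (cong (λ z → sum {n} (λ w → ⟦ X v w ⟧) - z)
          (trans (∑-distrib-+ {n} _ _) (cong₂ _+_ (trans (∑-distrib-+ {n} _ _)
            (cong₂ _+_ (A.E-row v) (B.E-row v))) (D.E-row v))))))) (odd v)

      Y-sym : ∀ v w → Y v w ≡ Y w v
      Y-sym v w = cong₂ (λ x y → x ∧ not y) (X-sym v w)
        (cong₂ _∨_ (A.E-sym v w) (cong₂ _∨_ (B.E-sym v w) (D.E-sym v w)))

      Y-irrefl : ∀ v → Y v v ≡ false
      Y-irrefl v = cong (_∧ not (A.E v v ∨ B.E v v ∨ D.E v v)) (X-irrefl v)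

      weight : Bool → Bool → Bool → ℤ
      weight p q r = ⟦ p ⟧ + ⟦ q ⟧ - + 2 * ⟦ r ⟧

      κ : Fin n → Fin n → ℤ
      κ v w = weight (A.E v w) (B.E v w) (D.E v w)

      κ-sym : ∀ v w → κ w v ≡ κ v w
      κ-sym v w = trans (cong (λ e → weight e (B.E w v) (D.E w v)) (A.E-sym w v))
        (cong₂ (weight (A.E v w)) (B.E-sym w v) (D.E-sym w v))

      κ-row : ∀ v → sum (κ v) ≡ 0ℤ
      κ-row v = trans (sum-minus {n} _ _) (cong₂ _-_
        (trans (∑-distrib-+ {n} _ _) (cong₂ _+_ (A.E-row v) (B.E-row v)))
        (trans (sym (*-distribˡ-sum {n} (+ 2) _)) (cong (+ 2 *_) (D.E-row v))))

      -- `χ` changes sign along every coloured edge, and `κ` vanishes elsewhere; multiplication by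
      -- `χ` thus turns the symmetric weight into an antisymmetric one.
      flip : ∀ v w → χ w * κ v w ≡ - (χ v * κ v w)
      flip v w = trans (go (A.E v w) (B.E v w) (D.E v w)
          (χ-a ∘ proj₂ ∘ A.E-true) (χ-b ∘ proj₂ ∘ B.E-true) (χ-c ∘ proj₂ ∘ D.E-true))
        (sym (ℤₚ.neg-distribˡ-* (χ v) (κ v w)))
        where
        go : ∀ p q r → (p ≡ true → χ w ≡ - χ v) → (q ≡ true → χ w ≡ - χ v) → (r ≡ true → χ w ≡ - χ v) →
          χ w * weight p q r ≡ - χ v * weight p q r
        go true  q     r     f _ _ = cong (_* weight true q r) (f refl)
        go false true  r     _ g _ = cong (_* weight false true r) (g refl)
        go false false true  _ _ h = cong (_* weight false false true) (h refl)
        go false false false _ _ _ = trans (ℤₚ.*-zeroʳ (χ w)) (sym (ℤₚ.*-zeroʳ (- χ v)))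

      small : ∀ {x p q r s f} → IsSign s → Kind x p q r →
        (x ∧ not (p ∨ q ∨ r) ≡ false → f ≡ 0ℤ) → (x ∧ not (p ∨ q ∨ r) ≡ true → Small f) →
        (x ≡ false → s * weight p q r + f ≡ 0ℤ) × (x ≡ true → Small (s * weight p q r + f))
      small {s = s} {f} sg none f-off f-on = (λ _ → cong₂ _+_ (ℤₚ.*-zeroʳ s) (f-off refl)) , λ ()
      small {s = s} {f} sg rest f-off f-on = (λ ()) , λ _ →
        subst Small (sym (trans (cong (_+ f) (ℤₚ.*-zeroʳ s)) (ℤₚ.+-identityˡ f))) (f-on refl)
      small (inj₁ refl) kindA f-off f-on rewrite f-off refl = (λ ()) , λ _ → (λ ()) , ℕ.s≤s (ℕ.s≤s ℕ.z≤n)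
      small (inj₂ refl) kindA f-off f-on rewrite f-off refl = (λ ()) , λ _ → (λ ()) , ℕ.s≤s (ℕ.s≤s ℕ.z≤n)
      small (inj₁ refl) kindB f-off f-on rewrite f-off refl = (λ ()) , λ _ → (λ ()) , ℕ.s≤s (ℕ.s≤s ℕ.z≤n)
      small (inj₂ refl) kindB f-off f-on rewrite f-off refl = (λ ()) , λ _ → (λ ()) , ℕ.s≤s (ℕ.s≤s ℕ.z≤n)
      small (inj₁ refl) kindC f-off f-on rewrite f-off refl = (λ ()) , λ _ → (λ ()) , ℕ.s≤s (ℕ.s≤s (ℕ.s≤s ℕ.z≤n))
      small (inj₂ refl) kindC f-off f-on rewrite f-off refl = (λ ()) , λ _ → (λ ()) , ℕ.s≤s (ℕ.s≤s (ℕ.s≤s ℕ.z≤n))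

      combine-flows : ∃ (Balanced Y) → ∃ (Balanced X)
      combine-flows (F , bal) = (λ v w → χ v * κ v w + F v w) , record
        { off      = λ v w → proj₁ (small (χ-sign v) (kind v w) (off v w) (on v w))
        ; small    = λ v w → proj₂ (small (χ-sign v) (kind v w) (off v w) (on v w))
        ; antisym  = λ v w → trans (cong₂ _+_ (trans (cong (χ w *_) (κ-sym v w)) (flip v w)) (antisym v w))
                       (sym (ℤₚ.neg-distrib-+ (χ v * κ v w) (F v w)))
        ; balanced = λ v → trans (∑-distrib-+ {n} _ _) (cong₂ _+_
                       (trans (sym (*-distribˡ-sum {n} (χ v) (κ v))) (trans (cong (χ v *_) (κ-row v)) (ℤₚ.*-zeroʳ (χ v))))
                       (balanced v)) }
        where
        open Balanced bal renaming (small to on)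

    abstract
      cubeFlow : ∃ (Balanced X)
      cubeFlow = combine-flows (eulerian Y Y-sym Y-irrefl Y-even)

-- Counting with Boolean predicates

-- `lower` selects the smaller element of every pair, and the larger elements are its translate
-- under the involution.
involution-even : ∀ {n} (p : Fin n → Bool) (ι : Fin n → Fin n) →
  (∀ {w} → p w ≡ true → p (ι w) ≡ true) → (∀ {w} → p w ≡ true → ι (ι w) ≡ w) →
  (∀ {w} → p w ≡ true → ι w ≢ w) → Even (sum (λ w → ⟦ p w ⟧))
involution-even {n} p ι closed invol free = sum lower ,
  trans (sum-cong-≗ {n} split) (trans (∑-distrib-+ {n} lower (lower ∘ ι′))
    (cong (λ z → sum lower + z) (sym (sum-permute lower (permutation ι′ ι′ ι′-invol ι′-invol)))))
  where
  -- Extending `ι` by the identity outside `p` yields a permutation of all indices, along which the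
  -- sum can be reindexed.
  ι′ : Fin n → Fin n
  ι′ w = if p w then ι w else w
  ι′-on : ∀ {w} → p w ≡ true → ι′ w ≡ ι w
  ι′-on {w} eq = cong (λ b → if b then ι w else w) eq
  ι′-off : ∀ {w} → p w ≡ false → ι′ w ≡ w
  ι′-off {w} eq = cong (λ b → if b then ι w else w) eq
  ι′-invol : ∀ w → ι′ (ι′ w) ≡ w
  ι′-invol w = go (p w) refl
    where
    go : ∀ b → p w ≡ b → ι′ (ι′ w) ≡ w
    go true  eq = trans (cong ι′ (ι′-on eq)) (trans (ι′-on (closed eq)) (invol eq))
    go false eq = trans (cong ι′ (ι′-off eq)) (ι′-off eq)
  lower : Fin n → ℤ
  lower w = ⟦ p w ∧ does (w Finₚ.<? ι w) ⟧
  split : ∀ w → ⟦ p w ⟧ ≡ lower w + lower (ι′ w)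
  split w = go (p w) refl
    where
    off : ∀ {u} → p u ≡ false → lower u ≡ 0ℤ
    off {u} eq = cong (λ b → ⟦ b ∧ does (u Finₚ.<? ι u) ⟧) eq
    on : ∀ {u v} → p u ≡ true → ι u ≡ v → lower u ≡ ⟦ does (u Finₚ.<? v) ⟧
    on {u} eq refl = cong (λ b → ⟦ b ∧ does (u Finₚ.<? ι u) ⟧) eq
    go : ∀ b → p w ≡ b → ⟦ p w ⟧ ≡ lower w + lower (ι′ w)
    go false eq = trans (cong ⟦_⟧ eq) (sym (cong₂ _+_ (off eq) (trans (cong lower (ι′-off eq)) (off eq))))
    go true  eq = trans (cong ⟦_⟧ eq) (sym (trans
        (cong₂ _+_ (on eq refl) (trans (cong lower (ι′-on eq)) (on (closed eq) (invol eq)))) (cmp (Finₚ.<-cmp w (ι w)))))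
      where
      cmp : _ → ⟦ does (w Finₚ.<? ι w) ⟧ + ⟦ does (ι w Finₚ.<? w) ⟧ ≡ 1ℤ
      cmp (tri< lt _ gt) = cong₂ (λ x y → ⟦ x ⟧ + ⟦ y ⟧) (dec-true (w Finₚ.<? ι w) lt) (dec-false (ι w Finₚ.<? w) gt)
      cmp (tri≈ _ e _)   = ⊥-elim (free eq (sym e))
      cmp (tri> lt _ gt) = cong₂ (λ x y → ⟦ x ⟧ + ⟦ y ⟧) (dec-false (w Finₚ.<? ι w) lt) (dec-true (ι w Finₚ.<? w) gt)

_∖_ : ∀ {n} → (Fin n → Bool) → Fin n → Fin n → Bool
(p ∖ w) u = p u ∧ not (does (u Finₚ.≟ w))

∖-true : ∀ {n} (p : Fin n → Bool) w {u} → (p ∖ w) u ≡ true → p u ≡ true × u ≢ w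
∖-true p w {u} eq with p u | u Finₚ.≟ w
... | true | no u≢w = refl , u≢w
∖-true p w {u} () | true  | yes _
∖-true p w {u} () | false | _

∖-intro : ∀ {n} (p : Fin n → Bool) w {u} → p u ≡ true → u ≢ w → (p ∖ w) u ≡ true
∖-intro p w {u} pu u≢w = cong₂ (λ x y → x ∧ not y) pu (dec-false (u Finₚ.≟ w) u≢w)

sum-∖ : ∀ {n} (p : Fin n → Bool) w → p w ≡ true → sum (λ u → ⟦ p u ⟧) ≡ 1ℤ + sum (λ u → ⟦ (p ∖ w) u ⟧)
sum-∖ {n} p w pw = trans (sum-replace w (λ u → ⟦ p u ⟧) (λ u → ⟦ (p ∖ w) u ⟧) same)
  (trans (cong₂ (λ x y → rest + (x - y)) (cong ⟦_⟧ pw) (cong ⟦_⟧ gone)) (ℤₚ.+-comm rest 1ℤ))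
  where
  rest = sum {n} (λ u → ⟦ (p ∖ w) u ⟧)
  gone : (p ∖ w) w ≡ false
  gone = trans (cong (λ b → p w ∧ not b) (dec-true (w Finₚ.≟ w) refl)) (Boolₚ.∧-zeroʳ (p w))
  same : ∀ u → u ≢ w → ⟦ p u ⟧ ≡ ⟦ (p ∖ w) u ⟧
  same u u≢w = cong ⟦_⟧ (sym (trans (cong (λ b → p u ∧ not b) (dec-false (u Finₚ.≟ w) u≢w)) (Boolₚ.∧-identityʳ (p u))))

pick : ∀ {n} (p : Fin n → Bool) {c} → sum (λ u → ⟦ p u ⟧) ≡ + suc c →
  ∃ λ w → p w ≡ true × sum (λ u → ⟦ (p ∖ w) u ⟧) ≡ + c
pick {n} p {c} eq with Finₚ.any? (λ w → p w Boolₚ.≟ true)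
... | yes (w , pw) = w , pw , ∙-cancelˡ 1ℤ _ (+ c) (trans (sym (sum-∖ p w pw)) eq)
... | no none = ⊥-elim (absurd (trans (sym (sum-0 {n} (λ u → cong ⟦_⟧ (Boolₚ.¬-not (λ e → none (u , e)))))) eq))
  where
  absurd : 0ℤ ≢ + suc c
  absurd ()

two-true : ∀ {n} (p : Fin n → Bool) {v w} → p v ≡ true → p w ≡ true → v ≢ w →
  ∃ λ t → sum (λ u → ⟦ p u ⟧) ≡ + (2 ℕ.+ t)
two-true {n} p {v} {w} pv pw v≢w =
  let t , eq = natural (sum-nonneg {n} (λ u → ⟦⟧-nonneg (((p ∖ v) ∖ w) u))) in
  t , trans (sum-∖ p v pv) (cong (λ z → 1ℤ + z) (trans (sum-∖ (p ∖ v) w (∖-intro p v pw (v≢w ∘ sym)))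
        (cong (λ z → 1ℤ + z) eq)))
  where
  natural : ∀ {z} → 0ℤ ℤ.≤ z → ∃ λ t → z ≡ + t
  natural {+ t} _ = t , refl

-- The derived series

module DerivedSeries {m : ℕ} (G : FinGroup m) where
  private
    grp : Group 0ℓ 0ℓ
    grp = record { isGroup = isGroup G }
  open GroupProperties grp using (inverseʳ-unique; ⁻¹-involutive) public
  open IsGroup (isGroup G) using (assoc; identityˡ; identityʳ; inverseˡ; inverseʳ) public

  infixl 7 _·_
  _·_ : Fin m → Fin m → Fin m
  _·_ = _∙_ G

  inv : Fin m → Fin m
  inv = _⁻¹ G

  conj : Fin m → Fin m → Fin m
  conj g x = inv g · x · g

  conj-· : ∀ g x y → conj g x · conj g y ≡ conj g (x · y)
  conj-· g x y = trans (assoc (inv g · x) g (conj g y)) (trans (cong (inv g · x ·_) drop)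
    (trans (sym (assoc (inv g · x) y g)) (cong (_· g) (assoc (inv g) x y))))
    where
    drop : g · (inv g · y · g) ≡ y · g
    drop = trans (sym (assoc g (inv g · y) g)) (cong (_· g)
      (trans (sym (assoc g (inv g) y)) (trans (cong (_· y) (inverseʳ g)) (identityˡ y))))

  conj-ε : ∀ g → conj g (ε G) ≡ ε G
  conj-ε g = trans (cong (_· g) (identityʳ (inv g))) (inverseˡ g)

  conj-inv : ∀ g x → conj g (inv x) ≡ inv (conj g x)
  conj-inv g x = inverseʳ-unique (conj g x) (conj g (inv x))
    (trans (conj-· g x (inv x)) (trans (cong (conj g) (inverseʳ x)) (conj-ε g)))

  -- `D (suc i)` is the subgroup generated by the commutators of `D i`. Its terms are normal in all
  -- of `G`, whereas a term of the series in `Solvable` is only required to be normal in the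
  -- preceding one.
  data D : ℕ → Fin m → Set where
    whole      : ∀ x → D 0 x
    unit       : ∀ {i} → D (suc i) (ε G)
    product    : ∀ {i x y} → D (suc i) x → D (suc i) y → D (suc i) (x · y)
    inverse    : ∀ {i x} → D (suc i) x → D (suc i) (inv x)
    commutator : ∀ {i x y} → D i x → D i y → D (suc i) (x · y · inv x · inv y)

  D-ε : ∀ i → D i (ε G)
  D-ε zero    = whole _
  D-ε (suc i) = unit

  D-· : ∀ {i x y} → D i x → D i y → D i (x · y)
  D-· {zero}  p q = whole _
  D-· {suc i} p q = product p q

  D-inv : ∀ {i x} → D i x → D i (inv x)
  D-inv {zero}  p = whole _
  D-inv {suc i} p = inverse p

  D-conj : ∀ {i x} g → D i x → D i (conj g x)
  D-conj g (whole x)     = whole _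
  D-conj g unit          = subst (D _) (sym (conj-ε g)) unit
  D-conj g (product p q) = subst (D _) (conj-· g _ _) (product (D-conj g p) (D-conj g q))
  D-conj g (inverse p)   = subst (D _) (sym (conj-inv g _)) (inverse (D-conj g p))
  D-conj g (commutator {i} {x} {y} p q) = subst (D _) eq (commutator (D-conj g p) (D-conj g q))
    where
    eq : conj g x · conj g y · inv (conj g x) · inv (conj g y) ≡ conj g (x · y · inv x · inv y)
    eq = trans (cong₂ (λ u v → conj g x · conj g y · u · v) (sym (conj-inv g x)) (sym (conj-inv g y)))
      (trans (cong (λ u → u · conj g (inv x) · conj g (inv y)) (conj-· g x y))
      (trans (cong (_· conj g (inv y)) (conj-· g (x · y) (inv x))) (conj-· g _ (inv y))))

  D-descending : ∀ {i x} → D (suc i) x → D i x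
  D-descending unit             = D-ε _
  D-descending (product p q)    = D-· (D-descending p) (D-descending q)
  D-descending (inverse p)      = D-inv (D-descending p)
  D-descending (commutator p q) = D-· (D-· (D-· p q) (D-inv p)) (D-inv q)

  -- Consecutive quotients of `H` are abelian, so by induction `D i` stays inside `H i`, and `H r`
  -- is trivial.
  D-trivial : Solvable G → ∃ λ r → ∀ x → D r x → x ≡ ε G
  D-trivial (r , H , sub , all , triv , _ , _ , comm) = r , λ x d → triv x (D⊆H ℕₚ.≤-refl d)
    where
    D⊆H : ∀ {i x} → i ℕ.≤ r → D i x → H i x
    D⊆H i≤r (whole x)        = all x
    D⊆H i≤r unit             = proj₁ (sub _ i≤r)
    D⊆H i≤r (product p q)    = proj₁ (proj₂ (sub _ i≤r)) _ _ (D⊆H i≤r p) (D⊆H i≤r q)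
    D⊆H i≤r (inverse p)      = proj₂ (proj₂ (sub _ i≤r)) _ (D⊆H i≤r p)
    D⊆H i≤r (commutator p q) = comm _ i≤r _ _ (D⊆H (ℕₚ.<⇒≤ i≤r) p) (D⊆H (ℕₚ.<⇒≤ i≤r) q)

-- Orbits of the derived series on the vertices

module Orbits {n m : ℕ} {Γ : Graph n} {G : FinGroup m} (A : ActsByAutomorphisms G Γ) where
  open DerivedSeries G

  infixl 8 _◂_
  _◂_ : Fin n → Fin m → Fin n
  _◂_ = act A

  ◂-inv : ∀ v g → v ◂ g ◂ inv g ≡ v
  ◂-inv v g = trans (act-comp A v g (inv g)) (trans (cong (v ◂_) (inverseʳ g)) (act-id A v))

  inv-◂ : ∀ v g → v ◂ inv g ◂ g ≡ v
  inv-◂ v g = trans (act-comp A v (inv g) g) (trans (cong (v ◂_) (inverseˡ g)) (act-id A v))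

  ◂-conj : ∀ v g x → v ◂ g ◂ conj g x ≡ v ◂ x ◂ g
  ◂-conj v g x = trans (sym (act-comp A (v ◂ g) (inv g · x) g)) (cong (_◂ g)
    (trans (sym (act-comp A (v ◂ g) (inv g) x)) (cong (_◂ x) (◂-inv v g))))

  Orb : ℕ → Fin n → Fin n → Set
  Orb i v w = ∃ λ x → D i x × v ◂ x ≡ w

  Orb-isEquivalence : ∀ i → IsEquivalence (Orb i)
  Orb-isEquivalence i = record
    { refl  = λ {v} → ε G , D-ε i , act-id A v
    ; sym   = λ { {v} (x , d , refl) → inv x , D-inv d , ◂-inv v x }
    ; trans = λ { {u} (x , d , refl) (y , e , refl) → x · y , D-· d e , sym (act-comp A u x y) } }

  -- Normality of `D i` in `G` means that `G` permutes its orbits.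
  Orb-act : ∀ {i v w} g → Orb i v w → Orb i (v ◂ g) (w ◂ g)
  Orb-act {i} {v} g (x , d , refl) = conj g x , D-conj g d , ◂-conj v g x

  Orb-descending : ∀ {i v w} → Orb (suc i) v w → Orb i v w
  Orb-descending (x , d , eq) = x , D-descending d , eq

  -- `D i` is abelian modulo `D (suc i)`: the commutator of the inverses of `y` and `x` first undoes
  -- `x` and `y` and then applies them in the other order.
  Orb-comm : ∀ {i x y} → D i x → D i y → ∀ v → Orb (suc i) (v ◂ x ◂ y) (v ◂ y ◂ x)
  Orb-comm {i} {x} {y} d e v =
    (y′ · x′ · inv y′ · inv x′) , commutator (D-inv e) (D-inv d) ,
      trans (sym (act-comp A _ _ (inv x′))) (trans (cong₂ _◂_ (trans (sym (act-comp A _ _ (inv y′)))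
        (cong₂ _◂_ undo (⁻¹-involutive y))) (⁻¹-involutive x)) refl)
    where
    x′ = inv x
    y′ = inv y
    undo : v ◂ x ◂ y ◂ (y′ · x′) ≡ v
    undo = trans (sym (act-comp A _ y′ x′)) (trans (cong (_◂ x′) (◂-inv (v ◂ x) y)) (◂-inv v x))

  adj-act : ∀ {v w} g → adj Γ v w ≡ true → adj Γ (v ◂ g) (w ◂ g) ≡ true
  adj-act {v} {w} g eq = trans (sym (act-adj A v w g)) eq

-- The layer of the derived series where twins disappear

Twins : ∀ {n} → Graph n → (Fin n → Fin n → Set) → Set
Twins Γ _~_ = ∃ λ v → ∃ λ w → ∃ λ w′ →
  adj Γ v w ≡ true × adj Γ v w′ ≡ true × w ≢ w′ × w ~ w′

module Layer {n m k : ℕ} {Γ : Graph n} {G : FinGroup m} (A : ActsByAutomorphisms G Γ) (AT : ArcTransitive A)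
  (degree-sum : ∀ v → sum {n} (λ w → ⟦ adj Γ v w ⟧) ≡ + k) (i : ℕ) where

  open DerivedSeries G
  open Orbits A

  -- Membership in `D i` is not decided by its generators, so decidability of both orbit relations
  -- is a parameter; it is later supplied under a double negation.
  module _ (N? : ∀ v w → Dec (Orb i v w)) (M? : ∀ v w → Dec (Orb (suc i) v w))
    (twins : Twins Γ (Orb i)) (no-twins : ¬ Twins Γ (Orb (suc i))) where

    private
      infix 4 _~_ _≈_
      _~_ _≈_ : Fin n → Fin n → Set
      _~_ = Orb i
      _≈_ = Orb (suc i)

      α β β′ : Fin n
      α  = proj₁ twins
      β  = proj₁ (proj₂ twins)
      β′ = proj₁ (proj₂ (proj₂ twins))
      αβ : adj Γ α β ≡ true
      αβ = proj₁ (proj₂ (proj₂ (proj₂ twins)))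
      αβ′ : adj Γ α β′ ≡ true
      αβ′ = proj₁ (proj₂ (proj₂ (proj₂ (proj₂ twins))))
      β≢β′ : β ≢ β′
      β≢β′ = proj₁ (proj₂ (proj₂ (proj₂ (proj₂ (proj₂ twins)))))
      β~β′ : β ~ β′
      β~β′ = proj₂ (proj₂ (proj₂ (proj₂ (proj₂ (proj₂ twins)))))

      ~-eq : IsDecEquivalence _~_
      ~-eq = record { isEquivalence = Orb-isEquivalence i ; _≟_ = N? }
      ≈-eq : IsDecEquivalence _≈_
      ≈-eq = record { isEquivalence = Orb-isEquivalence (suc i) ; _≟_ = M? }

      open IsEquivalence (Orb-isEquivalence i) using () renaming (sym to ~-sym)
      open IsEquivalence (Orb-isEquivalence (suc i)) using ()
        renaming (sym to ≈-sym; trans to ≈-trans; reflexive to ≈-reflexive)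
      open Canonical ~-eq

      arc-map : ∀ {v w v′ w′} → adj Γ v w ≡ true → adj Γ v′ w′ ≡ true → ∃ λ g → v ◂ g ≡ v′ × w ◂ g ≡ w′
      arc-map {v} {w} {v′} {w′} p q = proj₂ AT v w v′ w′ (subst T (sym p) _) (subst T (sym q) _)

    module _ (outer : ¬ α ~ β) where

      private
        count : Fin n → Fin n → ℤ
        count v w = sum {n} (λ w′ → ⟦ adj Γ v w′ ∧ does (rep w′ Finₚ.≟ rep w) ⟧)

        rep-act : ∀ g w w′ → does (rep (w′ ◂ g) Finₚ.≟ rep (w ◂ g)) ≡ does (rep w′ Finₚ.≟ rep w)
        rep-act g w w′ with rep w′ Finₚ.≟ rep w
        ... | yes eq = dec-true (rep (w′ ◂ g) Finₚ.≟ rep (w ◂ g)) (rep-cong (Orb-act g (rep-injective eq)))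
        ... | no ne  = dec-false (rep (w′ ◂ g) Finₚ.≟ rep (w ◂ g)) λ eq → ne (rep-cong
            (subst₂ _~_ (◂-inv w′ g) (◂-inv w g) (Orb-act (inv g) (rep-injective eq))))

        -- `g` permutes the vertices and preserves adjacency and classes. By arc-transitivity the
        -- count is therefore the same for all arcs.
        count-act : ∀ g v w → count (v ◂ g) (w ◂ g) ≡ count v w
        count-act g v w = trans (sum-permute {n} {n} _ (permutation (_◂ g) (_◂ inv g) (λ u → inv-◂ u g) (λ u → ◂-inv u g)))
          (sum-cong-≗ {n} λ w′ → cong ⟦_⟧ (cong₂ _∧_ (sym (act-adj A v w′ g)) (rep-act g w w′)))

        αβ-count : ∃ λ t → count α β ≡ + (2 ℕ.+ t)
        αβ-count = two-true (λ w′ → adj Γ α w′ ∧ does (rep w′ Finₚ.≟ rep β))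
          (cong₂ _∧_ αβ (dec-true (rep β Finₚ.≟ rep β) refl))
          (cong₂ _∧_ αβ′ (dec-true (rep β′ Finₚ.≟ rep β) (rep-cong (~-sym β~β′)))) β≢β′

      outerFlow : ∃ (Balanced (adj Γ))
      outerFlow = multicover (adj Γ) (symm Γ) rep (proj₁ αβ-count)
        (λ v w vw eq → let g , e , e′ = arc-map vw αβ in
          outer (subst₂ _~_ e e′ (Orb-act g (rep-injective eq))))
        (λ v w vw → let g , e , e′ = arc-map αβ vw in
          trans (sym (cong₂ count e e′)) (trans (count-act g α β) (proj₂ αβ-count)))

    module _ (inner : α ~ β) {k₄ : ℕ} (k≡ : k ≡ 4 ℕ.+ k₄) (odd : ¬ Even (+ k)) (k-3-even : Even (+ k - + 3)) where

      private
        unique : ∀ {v w w′} → adj Γ v w ≡ true → adj Γ v w′ ≡ true → w ≈ w′ → w ≡ w′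
        unique {v} {w} {w′} p q w≈w′ with w Finₚ.≟ w′
        ... | yes eq = eq
        ... | no ne  = ⊥-elim (no-twins (v , w , w′ , p , q , ne , w≈w′))

        -- If one arc lay inside an orbit of `D (suc i)`, all would; then `β` and `β′` would both be
        -- equivalent to `α` and hence equal by `unique`.
        arc-≉ : ∀ {v w} → adj Γ v w ≡ true → ¬ v ≈ w
        arc-≉ p v≈w =
          let g , e , e′ = arc-map p αβ
              h , d , d′ = arc-map p αβ′
          in β≢β′ (unique αβ αβ′ (≈-trans (≈-sym (subst₂ _≈_ e e′ (Orb-act g v≈w)))
                                          (subst₂ _≈_ d d′ (Orb-act h v≈w))))

        arc-~ : ∀ {v w} → adj Γ v w ≡ true → v ~ w
        arc-~ p = let g , e , e′ = arc-map αβ p in subst₂ _~_ e e′ (Orb-act g inner)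

        swap-adj : ∀ {v w} → adj Γ v w ≡ true → adj Γ w v ≡ true
        swap-adj {v} {w} p = trans (symm Γ w v) p

        back-adj : ∀ {v} x → adj Γ v (v ◂ x) ≡ true → adj Γ v (v ◂ inv x) ≡ true
        back-adj {v} x p = swap-adj (subst (λ u → adj Γ (v ◂ inv x) u ≡ true) (◂-inv v x) (adj-act (inv x) p))

        -- Inversion of the connection set at `α`: `α ◂ x` goes to `α ◂ inv x`. The default outside
        -- the orbit of `α` is harmless, as no neighbour lies there.
        opposite : Fin n → Fin n
        opposite w with N? α w
        ... | yes (x , _) = α ◂ inv x
        ... | no _        = w

        opposite-spec : ∀ {w} → adj Γ α w ≡ true → ∃ λ x → D i x × α ◂ x ≡ w × opposite w ≡ α ◂ inv x
        opposite-spec {w} p with N? α w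
        ... | yes (x , d , eq) = x , d , eq , refl
        ... | no ne            = ⊥-elim (ne (arc-~ p))

        opposite-adj : ∀ {w} → adj Γ α w ≡ true → adj Γ α (opposite w) ≡ true
        opposite-adj p with opposite-spec p
        ... | x , d , refl , eq = subst (λ u → adj Γ α u ≡ true) (sym eq) (back-adj x p)

        -- The element `y` found for the opposite vertex agrees with `inv x` at `α` only. Commuting
        -- `inv y` with `x` modulo `D (suc i)` relates the two results, and `unique` makes them
        -- equal.
        opposite-invol : ∀ {w} → adj Γ α w ≡ true → opposite (opposite w) ≡ w
        opposite-invol {w} p with opposite-spec p | opposite-spec (opposite-adj p)
        ... | x , d , αx , eq | y , e , αy , eq′ =
          unique (opposite-adj (opposite-adj p)) p (≈-sym (subst₂ _≈_ from to (Orb-comm (D-inv e) d (α ◂ y))))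
          where
          from : α ◂ y ◂ inv y ◂ x ≡ w
          from = trans (cong (_◂ x) (◂-inv α y)) αx
          to : α ◂ y ◂ x ◂ inv y ≡ opposite (opposite w)
          to = trans (cong (λ u → u ◂ x ◂ inv y) (trans αy eq)) (trans (cong (_◂ inv y) (inv-◂ α x)) (sym eq′))

        Swaps : Fin n → Fin n → Set
        Swaps v w = ∃ λ x → D i x × v ◂ x ≡ w × w ◂ x ≡ v

        -- The valency is odd, so some neighbour of α is fixed by opposite.
        fixed-swap : ∃ λ w → adj Γ α w ≡ true × Swaps α w
        fixed-swap with Finₚ.any? (λ w → (adj Γ α w Boolₚ.≟ true) ×-dec (opposite w Finₚ.≟ w))
        ... | yes (w , p , eq) = let x , d , αx , eq′ = opposite-spec p in
              w , p , x , d , αx , trans (cong (_◂ x) (trans (sym eq) eq′)) (inv-◂ α x)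
        ... | no none = ⊥-elim (odd (subst Even (degree-sum α)
              (involution-even (adj Γ α) opposite opposite-adj opposite-invol (λ {w} p eq → none (w , p , eq)))))

        abstract
          -- Arc-transitivity carries the swap found at `α` to every arc, by conjugation inside the
          -- normal subgroup `D i`.
          arc-swaps : ∀ {v w} → adj Γ v w ≡ true → Swaps v w
          arc-swaps {v} {w} p =
            let w₀ , p₀ , x , d , αx , wx = fixed-swap
                g , e , e′ = arc-map p₀ p
            in conj g x , D-conj g d ,
               trans (cong (_◂ conj g x) (sym e)) (trans (◂-conj α g x) (trans (cong (_◂ g) αx) e′)) ,
               trans (cong (_◂ conj g x) (sym e′)) (trans (◂-conj w₀ g x) (trans (cong (_◂ g) wx) e))

        -- The involution law is required at `v` alone; on the rest of its orbit it follows modulo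
        -- `D (suc i)`.
        record Colour (v : Fin n) : Set where
          constructor colour
          field
            elt : Fin m
            elt∈ : D i elt
            edge : adj Γ v (v ◂ elt) ≡ true
            twice : v ◂ elt ◂ elt ≡ v
        open Colour

        toColour : ∀ {v w} → adj Γ v w ≡ true → Σ (Colour v) λ a → v ◂ elt a ≡ w
        toColour p with arc-swaps p
        ... | x , d , refl , eq = colour x d p eq , refl

        record Frame (v : Fin n) : Set where
          field
            a b c : Colour v
            a≢b : v ◂ elt a ≢ v ◂ elt b
            a≢c : v ◂ elt a ≢ v ◂ elt c
            b≢c : v ◂ elt b ≢ v ◂ elt c
            indep : ¬ v ◂ elt b ◂ elt a ≈ v ◂ elt c

        abstract
          -- Here the valency must be at least 4: by `unique` at most one neighbour is equivalent to
          -- `v ◂ elt b ◂ elt a`, so the third or the fourth neighbour can serve as `c`.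
          frame : ∀ v → Frame v
          frame v =
            let p₀ = adj Γ v
                w₁ , e₁ , s₁ = pick p₀ (trans (degree-sum v) (cong +_ k≡))
                p₁ = p₀ ∖ w₁
                w₂ , e₂ , s₂ = pick p₁ s₁
                p₂ = p₁ ∖ w₂
                w₃ , e₃ , s₃ = pick p₂ s₂
                p₃ = p₂ ∖ w₃
                w₄ , e₄ , _ = pick p₃ s₃
                v₂ , w₂≢w₁ = ∖-true p₀ w₁ e₂
                e₃′ , w₃≢w₂ = ∖-true p₁ w₂ e₃
                v₃ , w₃≢w₁ = ∖-true p₀ w₁ e₃′
                e₄′ , w₄≢w₃ = ∖-true p₂ w₃ e₄
                e₄″ , w₄≢w₂ = ∖-true p₁ w₂ e₄′
                v₄ , w₄≢w₁ = ∖-true p₀ w₁ e₄″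
            in choose e₁ v₂ v₃ v₄ (w₂≢w₁ ∘ sym) (w₃≢w₁ ∘ sym) (w₃≢w₂ ∘ sym) (w₄≢w₁ ∘ sym) (w₄≢w₂ ∘ sym) (w₄≢w₃ ∘ sym)
            where
            choose : ∀ {w₁ w₂ w₃ w₄} → adj Γ v w₁ ≡ true → adj Γ v w₂ ≡ true → adj Γ v w₃ ≡ true → adj Γ v w₄ ≡ true →
              w₁ ≢ w₂ → w₁ ≢ w₃ → w₂ ≢ w₃ → w₁ ≢ w₄ → w₂ ≢ w₄ → w₃ ≢ w₄ → Frame v
            choose v₁ v₂ v₃ v₄ n₁₂ n₁₃ n₂₃ n₁₄ n₂₄ n₃₄ with toColour v₁ | toColour v₂ | toColour v₃ | toColour v₄
            ... | a , refl | b , refl | c , refl | d , refl with M? (v ◂ elt b ◂ elt a) (v ◂ elt c)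
            ...   | no ne = record { a = a ; b = b ; c = c ; a≢b = n₁₂ ; a≢c = n₁₃ ; b≢c = n₂₃ ; indep = ne }
            ...   | yes ba≈c = record { a = a ; b = b ; c = d ; a≢b = n₁₂ ; a≢c = n₁₄ ; b≢c = n₂₄
                    ; indep = λ ba≈d → n₃₄ (unique v₃ v₄ (≈-trans (≈-sym ba≈c) ba≈d)) }

        -- The element of `D i` that moves `v` to `w` commutes with `x` and `x′` modulo `D (suc i)`,
        -- so a coincidence at one vertex spreads over the whole orbit.
        transport : ∀ {x x′ v w} → D i x → D i x′ → v ~ w → v ◂ x ≈ v ◂ x′ → w ◂ x ≈ w ◂ x′
        transport dx dx′ (y , dy , refl) p =
          ≈-trans (Orb-comm dy dx _) (≈-trans (Orb-act y p) (Orb-comm dx′ dy _))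

        -- Colours are chosen at one representative of each orbit of D i and spread along the orbit.
        module Spread (col : ∀ v → Colour v) where

          x : Fin n → Fin m
          x v = elt (col (rep v))

          x∈ : ∀ v → D i (x v)
          x∈ v = elt∈ (col (rep v))

          f : Fin n → Fin n
          f v = v ◂ x v

          x-cong : ∀ {v w} → v ~ w → x v ≡ x w
          x-cong p = cong (λ u → elt (col u)) (rep-cong p)

          f-~ : ∀ v → v ~ f v
          f-~ v = x v , x∈ v , refl

          f-resp : ∀ {v w} → v ≈ w → f v ≈ f w
          f-resp {v} {w} p = subst (λ y → f v ≈ w ◂ y) (x-cong (Orb-descending p)) (Orb-act (x v) p)

          f-invol : ∀ v → f (f v) ≈ v
          f-invol v = subst (λ y → f v ◂ y ≈ v) (x-cong (f-~ v))
            (subst₂ _≈_ (sym (act-comp A v (x v) (x v))) (act-id A v)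
              (transport (D-· (x∈ v) (x∈ v)) (D-ε i) (~-sym (≈-rep v))
                (≈-reflexive (trans (sym (act-comp A _ _ _)) (trans (twice (col (rep v))) (sym (act-id A _)))))))

          -- The coloured edge at the representative is moved to `v` by an element `y` of `D i`, and
          -- `y` commutes with the colour modulo `D (suc i)`.
          f-nbr : ∀ v → ∃ λ w → adj Γ v w ≡ true × w ≈ f v
          f-nbr v with ~-sym (≈-rep v)
          ... | y , dy , eq = rep v ◂ x v ◂ y ,
                subst (λ u → adj Γ u (rep v ◂ x v ◂ y) ≡ true) eq (adj-act y (edge (col (rep v)))) ,
                ≈-trans (Orb-comm (x∈ v) dy (rep v)) (≈-reflexive (cong (_◂ x v) eq))

          f-free : ∀ v → ¬ f v ≈ v
          f-free v p = let w , vw , w≈ = f-nbr v in arc-≉ vw (≈-sym (≈-trans w≈ p))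

        f-comm : ∀ (a b : ∀ v → Colour v) v → Spread.f a (Spread.f b v) ≈ Spread.f b (Spread.f a v)
        f-comm a b v = subst₂ (λ y z → v ◂ Spread.x b v ◂ y ≈ v ◂ Spread.x a v ◂ z)
          (Spread.x-cong a (Spread.f-~ b v)) (Spread.x-cong b (Spread.f-~ a v))
          (Orb-comm (Spread.x∈ b v) (Spread.x∈ a v) v)

        f-distinct : ∀ (a b : ∀ v → Colour v) → (∀ v → v ◂ elt (a v) ≢ v ◂ elt (b v)) →
          ∀ v → ¬ Spread.f a v ≈ Spread.f b v
        f-distinct a b ne v p = ne (rep v) (unique (edge (a (rep v))) (edge (b (rep v)))
          (transport (Spread.x∈ a v) (Spread.x∈ b v) (≈-rep v) p))

        fa fb fc : ∀ v → Colour v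
        fa v = Frame.a (frame v)
        fb v = Frame.b (frame v)
        fc v = Frame.c (frame v)

        module SA = Spread fa
        module SB = Spread fb
        module SC = Spread fc

        f-indep : ∀ v → ¬ SA.f (SB.f v) ≈ SC.f v
        f-indep v p = Frame.indep (frame (rep v)) (subst (_≈ rep v ◂ SC.x v) (sym (act-comp A _ _ _))
          (transport (D-· (SB.x∈ v) (SA.x∈ v)) (SC.x∈ v) (≈-rep v)
            (subst (_≈ v ◂ SC.x v) (trans (cong (SB.f v ◂_) (SA.x-cong (~-sym (SB.f-~ v)))) (act-comp A _ _ _)) p)))

      innerFlow : ∃ (Balanced (adj Γ))
      innerFlow = Cube.cubeFlow ≈-eq SA.f SB.f SC.f SA.f-resp SB.f-resp SC.f-resp
        SA.f-invol SB.f-invol SC.f-invol (f-comm fa fb) (f-comm fa fc) (f-comm fb fc)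
        SA.f-free SB.f-free SC.f-free f-indep
        (adj Γ) (symm Γ) (irrefl Γ) unique SA.f-nbr SB.f-nbr SC.f-nbr
        (f-distinct fa fb (λ v → Frame.a≢b (frame v))) (f-distinct fa fc (λ v → Frame.a≢c (frame v)))
        (f-distinct fb fc (λ v → Frame.b≢c (frame v)))
        (λ v → subst (λ z → Even (z - + 3)) (sym (degree-sum v)) k-3-even)

-- From balanced functions to flows

sumℤ-map-allFin : ∀ n (f : Fin n → ℤ) → sumℤ (map f (allFin n)) ≡ sum f
sumℤ-map-allFin n f = trans (cong sumℤ (Listₚ.map-tabulate (λ i → i) f)) (sumℤ-tabulate n f)
  where
  sumℤ-tabulate : ∀ n (f : Fin n → ℤ) → sumℤ (tabulate f) ≡ sum f
  sumℤ-tabulate zero    f = refl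
  sumℤ-tabulate (suc n) f = cong (λ z → f zero + z) (sumℤ-tabulate n (f ∘ suc))

degree-as-sum : ∀ {n} (Γ : Graph n) v → sum (λ w → ⟦ adj Γ v w ⟧) ≡ + degree Γ v
degree-as-sum {n} Γ v = sym (count n (λ w → w))
  where
  count : ∀ l (f : Fin l → Fin n) → + length (filterᵇ (adj Γ v) (tabulate f)) ≡ sum (λ i → ⟦ adj Γ v (f i) ⟧)
  count zero    f = refl
  count (suc l) f with adj Γ v (f zero)
  ... | true  = cong (λ z → 1ℤ + z) (count l (f ∘ suc))
  ... | false = trans (count l (f ∘ suc)) (sym (ℤₚ.+-identityˡ _))

positive? : ℤ → Bool
positive? (+ zero)     = false
positive? (+ suc _)    = true
positive? ℤ.-[1+ _ ]   = false

-- size (two? z) is the absolute value of z for z = ±1, ±2, and junk otherwise.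
two? : ℤ → Bool
two? z = does (ℤ.∣ z ∣ ℕₚ.≟ 2)

size : Bool → ℤ
size two = if two then + 2 else 1ℤ

data Unit₃ : ℤ → Set where
  +1′ : Unit₃ 1ℤ
  +2′ : Unit₃ (+ 2)
  -1′ : Unit₃ -1ℤ
  -2′ : Unit₃ ℤ.-[1+ 1 ]

unit₃ : ∀ {z} → Small z → Unit₃ z
unit₃ {+ 0} (nz , _) = ⊥-elim (nz refl)
unit₃ {+ 1} _ = +1′
unit₃ {+ 2} _ = +2′
unit₃ {+ suc (suc (suc _))} (_ , ℕ.s≤s (ℕ.s≤s (ℕ.s≤s ())))
unit₃ {ℤ.-[1+ 0 ]} _ = -1′
unit₃ {ℤ.-[1+ 1 ]} _ = -2′
unit₃ {ℤ.-[1+ suc (suc _) ]} (_ , ℕ.s≤s (ℕ.s≤s (ℕ.s≤s ())))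

size-range : ∀ b → InRange 3 (size b) × size b ≢ 0ℤ
size-range true  = ℕ.s≤s (ℕ.s≤s (ℕ.s≤s ℕ.z≤n)) , λ ()
size-range false = ℕ.s≤s (ℕ.s≤s ℕ.z≤n) , λ ()

module _ {n : ℕ} (Γ : Graph n) where

  -- `t` records which edges carry 2 instead of 1. A candidate is thus a pair of Boolean matrices,
  -- and there are finitely many of them.
  NZFlow : (o t : Fin n → Fin n → Bool) → Set
  NZFlow o t = IsFlow Γ 3 o f × IsNowhereZero Γ f
    where
    f : Fin n → Fin n → ℤ
    f u v = size (t u v)

  -- `o` and `t` are tied to `F` by pointwise equations, since matrices read back from their
  -- encoding as subsets agree with the intended ones only pointwise.
  balanced⇒flow : ∀ {F} → Balanced (adj Γ) F → (o t : Fin n → Fin n → Bool) →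
    (∀ u v → o u v ≡ positive? (F u v)) → (∀ u v → t u v ≡ two? (F u v)) → NZFlow o t
  balanced⇒flow {F} bal o t o≡ t≡ =
    (orientation , edge , (λ u v _ → proj₁ (size-range (t u v))) , conserve) , λ u v _ → proj₂ (size-range (t u v))
    where
    open Balanced bal
    unitF : ∀ u v → Adj Γ u v → Unit₃ (F u v)
    unitF u v p = unit₃ (small u v (Equivalence.to Boolₚ.T-≡ p))
    orientation : IsOrientation Γ o
    orientation u v p rewrite o≡ u v | o≡ v u | antisym u v with F u v | unitF u v p
    ... | _ | +1′ = inj₁ (_ , λ ())
    ... | _ | +2′ = inj₁ (_ , λ ())
    ... | _ | -1′ = inj₂ (_ , λ ())
    ... | _ | -2′ = inj₂ (_ , λ ())
    edge : IsEdgeFunction Γ (λ u v → size (t u v))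
    edge u v p rewrite t≡ u v | t≡ v u | antisym u v with F u v | unitF u v p
    ... | _ | +1′ = refl
    ... | _ | +2′ = refl
    ... | _ | -1′ = refl
    ... | _ | -2′ = refl
    -- On each edge the outflow minus the inflow at `v` is `F v w`, so summation over `w` reduces
    -- conservation to `balanced`.
    term : ∀ v w → (if adj Γ v w ∧ o v w then size (t v w) else 0ℤ) ≡
      F v w + (if adj Γ v w ∧ o w v then size (t w v) else 0ℤ)
    term v w rewrite o≡ v w | o≡ w v | t≡ v w | t≡ w v | antisym v w = go (adj Γ v w) refl
      where
      go : ∀ b → adj Γ v w ≡ b → (if b ∧ positive? (F v w) then size (two? (F v w)) else 0ℤ) ≡
        F v w + (if b ∧ positive? (- F v w) then size (two? (- F v w)) else 0ℤ)
      go false eq = sym (cong (λ z → z + 0ℤ) (off v w eq))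
      go true  eq with F v w | unitF v w (subst T (sym eq) _)
      ... | _ | +1′ = refl
      ... | _ | +2′ = refl
      ... | _ | -1′ = refl
      ... | _ | -2′ = refl
    conserve : ∀ v → outSum Γ o (λ u w → size (t u w)) v ≡ inSum Γ o (λ u w → size (t u w)) v
    conserve v = trans (sumℤ-map-allFin n _) (trans (sum-cong-≗ {n} (term v))
      (trans (∑-distrib-+ {n} (F v) _) (trans (cong (λ z → z + _) (balanced v))
        (trans (ℤₚ.+-identityˡ _) (sym (sumℤ-map-allFin n _))))))

  NZFlow? : ∀ o t → Dec (NZFlow o t)
  NZFlow? o t =
    ((∀∀? λ u v → T? (adj Γ u v) →-dec ((T? (o u v) ×-dec ¬? (T? (o v u))) ⊎-dec (T? (o v u) ×-dec ¬? (T? (o u v)))))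
      ×-dec (∀∀? λ u v → T? (adj Γ u v) →-dec (_ ℤₚ.≟ _))
      ×-dec (∀∀? λ u v → T? (adj Γ u v) →-dec (_ ℕₚ.<? _))
      ×-dec Finₚ.all? (λ v → _ ℤₚ.≟ _))
    ×-dec (∀∀? λ u v → T? (adj Γ u v) →-dec ¬? (_ ℤₚ.≟ _))
    where
    ∀∀? : {P : Fin n → Fin n → Set} → (∀ u v → Dec (P u v)) → Dec (∀ u v → P u v)
    ∀∀? P? = Finₚ.all? (λ u → Finₚ.all? (P? u))

  private
    matrix : Subset (n ℕ.* n) → Fin n → Fin n → Bool
    matrix S u v = Vec.lookup S (combine u v)

    fromMatrix : (Fin n → Fin n → Bool) → Subset (n ℕ.* n)
    fromMatrix o = Vec.tabulate λ k → let u , v = remQuot {n} n k in o u v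

    matrix-from : ∀ o u v → matrix (fromMatrix o) u v ≡ o u v
    matrix-from o u v = trans (Vecₚ.lookup∘tabulate {n = n ℕ.* n} (λ k → let u , v = remQuot {n} n k in o u v) (combine u v))
      (cong (λ p → o (proj₁ p) (proj₂ p)) (Finₚ.remQuot-combine u v))

  -- The candidates are finite in number, so classical reasoning is available for finding a flow.
  stableFlow : ¬ ¬ ∃ (Balanced (adj Γ)) → HasNZFlow Γ 3
  stableFlow ¬¬bal =
    let S , S′ , flow = decidable-stable (anySubset? λ S → anySubset? λ S′ → NZFlow? (matrix S) (matrix S′))
                          (λ none → ¬¬bal (none ∘ encode))
    in matrix S , (λ u v → size (matrix S′ u v)) , flow
    where
    encode : ∃ (Balanced (adj Γ)) → ∃ λ S → ∃ λ S′ → NZFlow (matrix S) (matrix S′)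
    encode (F , bal) = fromMatrix o , fromMatrix t , balanced⇒flow bal _ _ (matrix-from o) (matrix-from t)
      where
      o t : Fin n → Fin n → Bool
      o u v = positive? (F u v)
      t u v = two? (F u v)

-- Choice of the layer under double negation, and the parity cases

¬¬-Dec : (P : Set) → ¬ ¬ Dec P
¬¬-Dec P h = h (no λ p → h (yes p))

¬¬-∀ : ∀ {n} {P : Fin n → Set} → (∀ i → ¬ ¬ P i) → ¬ ¬ (∀ i → P i)
¬¬-∀ {zero}  h k = k λ ()
¬¬-∀ {suc n} h k = h zero λ p → ¬¬-∀ (h ∘ suc) λ ps → k λ { zero → p ; (suc i) → ps i }

¬¬-Dec₂ : ∀ {n} (R : Fin n → Fin n → Set) → ¬ ¬ (∀ v w → Dec (R v w))
¬¬-Dec₂ R = ¬¬-∀ λ v → ¬¬-∀ λ w → ¬¬-Dec (R v w)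

-- If no such `i` existed, `P` would remain irrefutable from 0 up to `r`. As `P` is not decidable,
-- the conclusion is doubly negated.
last-true : (P : ℕ → Set) (r : ℕ) → P 0 → ¬ P r → ¬ ¬ ∃ λ i → P i × ¬ P (suc i)
last-true P r p₀ ¬pᵣ none = always r ¬pᵣ
  where
  always : ∀ i → ¬ ¬ P i
  always zero    h = h p₀
  always (suc i) h = always i λ p → none (i , p , h)

parity : ∀ k → Even (+ k) ⊎ (¬ Even (+ k) × Even (+ k - + 3))
parity k with odd? k in eq
... | false = inj₁ (h , trans (half-oddℤ k) (trans (cong (λ b → h + h + ⟦ b ⟧) eq) (ℤₚ.+-identityʳ _)))
  where
  h = + ℕ.⌊ k /2⌋
... | true  = inj₂ ((λ { (q , e) → 1-odd (q - h , remaining-double h 1ℤ q (trans (sym k≡) e)) }) ,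
                    (h - 1ℤ , trans (cong (_- + 3) k≡) (lem h)))
  where
  h = + ℕ.⌊ k /2⌋
  k≡ : + k ≡ h + h + 1ℤ
  k≡ = trans (half-oddℤ k) (cong (λ b → h + h + ⟦ b ⟧) eq)
  lem : ∀ h → h + h + 1ℤ - + 3 ≡ (h - 1ℤ) + (h - 1ℤ)
  lem = solve-∀

module _ {n m k : ℕ} (Γ : Graph (suc n)) (4≤k : 4 ℕ.≤ k) (G : FinGroup m) (solvable : Solvable G)
  (A : ActsByAutomorphisms G Γ) (AT : ArcTransitive A)
  (degree-sum : ∀ v → sum {suc n} (λ w → ⟦ adj Γ v w ⟧) ≡ + k)
  (odd : ¬ Even (+ k)) (k-3-even : Even (+ k - + 3)) where

  open DerivedSeries G
  open Orbits A

  private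
    k≡ : k ≡ 4 ℕ.+ (k ℕ.∸ 4)
    k≡ = sym (ℕₚ.m+[n∸m]≡n 4≤k)

    -- `D 0` is all of `G` and transitive on vertices, so any two neighbours of a vertex are twins.
    twins₀ : Twins Γ (Orb 0)
    twins₀ =
      let p = adj Γ zero
          w , e , s = pick p (trans (degree-sum zero) (cong +_ k≡))
          w′ , e′ , _ = pick (p ∖ w) s
          e″ , w′≢w = ∖-true p w e′
          g , wg = proj₁ AT w w′
      in zero , w , w′ , e , e″ , w′≢w ∘ sym , g , whole g , wg

    r : ℕ
    r = proj₁ (D-trivial solvable)

    no-twinsᵣ : ¬ Twins Γ (Orb r)
    no-twinsᵣ (_ , w , w′ , _ , _ , w≢w′ , x , d , wx) =
      w≢w′ (trans (sym (act-id A w)) (trans (cong (w ◂_) (sym (proj₂ (D-trivial solvable) x d))) wx))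

  solvableFlow : ¬ ¬ ∃ (Balanced (adj Γ))
  solvableFlow none =
    last-true (λ i → Twins Γ (Orb i)) r twins₀ no-twinsᵣ λ { (i , twins , no-twins) →
    ¬¬-Dec₂ (Orb i) λ N? → ¬¬-Dec₂ (Orb (suc i)) λ M? →
    none (flow i N? M? twins no-twins (N? (proj₁ twins) (proj₁ (proj₂ twins)))) }
    where
    flow : ∀ i N? M? (twins : Twins Γ (Orb i)) → ¬ Twins Γ (Orb (suc i)) →
      Dec (Orb i (proj₁ twins) (proj₁ (proj₂ twins))) → ∃ (Balanced (adj Γ))
    flow i N? M? twins no-twins (yes inner) =
      Layer.innerFlow A AT degree-sum i N? M? twins no-twins inner k≡ odd k-3-even
    flow i N? M? twins no-twins (no outer) =
      Layer.outerFlow A AT degree-sum i N? M? twins no-twins outer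

theorem1p5 : ∀ {n m : ℕ} (Γ : Graph n) (k : ℕ) → 4 ≤ k → Regular Γ k →
    (G : FinGroup m) → Solvable G →
    (A : ActsByAutomorphisms G Γ) → ArcTransitive A →
    HasNZFlow Γ 3
theorem1p5 {zero} Γ k 4≤k reg G sol A AT =
  -- The null graph is treated apart because the search for twins starts from a vertex.
  stableFlow Γ λ none → none ((λ ()) , record { off = λ () ; small = λ () ; antisym = λ () ; balanced = λ () })
theorem1p5 {suc n} Γ k 4≤k reg G sol A AT = stableFlow Γ (byParity (parity k))
  where
  degree-sum : ∀ v → sum {suc n} (λ w → ⟦ adj Γ v w ⟧) ≡ + k
  degree-sum v = trans (degree-as-sum Γ v) (cong +_ (reg v))
  byParity : Even (+ k) ⊎ (¬ Even (+ k) × Even (+ k - + 3)) → ¬ ¬ ∃ (Balanced (adj Γ))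
  byParity (inj₁ even) none =
    none (eulerian (adj Γ) (symm Γ) (irrefl Γ) (λ v → subst Even (sym (degree-sum v)) even))
  byParity (inj₂ (odd , k-3-even)) = solvableFlow Γ 4≤k G sol A AT degree-sum odd k-3-even
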